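{- Let $G$ be a Berge graph, and let $X,Y$ be disjoint nonempty anticonnected subsets of $V(G)$ with $X$ complete to $Y$. Let $P$ be a path in $G\setminus(X\cup Y)$ of even length $>0$ with vertices $p_1,\dots,p_n$ in order, such that $p_1$ is the unique $X$-complete vertex of $P$ and $p_n$ is the unique $Y$-complete vertex of $P$. Then one of the following holds: (1) $P$ has length $\ge 4$ and there are nonadjacent $x_1,x_2\in X$ such that $x_1\hbox{ - }p_2\hbox{ - }\cdots\hbox{ - }p_n\hbox{ - }x_2$ is a path; (2) $P$ has length $\ge 4$ and there are nonadjacent $y_1,y_2\in Y$ such that $y_1\hbox{ - }p_1\hbox{ - }\cdots\hbox{ - }p_{n-1}\hbox{ - }y_2$ is a path; (3) $P$ has length $2$ and there is an antipath $Q$ between $p_2$ and $p_3$ with interior in $X$ and an antipath $R$ between $p_1$ and $p_2$ with interior in $Y$, and exactly one of $Q,R$ has odd length. In each case, either the pair $(V(P)\setminus\{p_1\},X)$ or the pair $(V(P)\setminus\{p_n\},Y)$ is not balanced.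
   Context: Graphs are finite and simple. Hole: induced cycle of length $\ge4$; antihole: induced subgraph whose complement is a hole; Berge: all holes and antiholes even. A path means an induced subgraph that is a path (writing $u_1\hbox{ - }\cdots\hbox{ - }u_k$ is a path means the induced subgraph on these vertices is a path with them in this order); an antipath is an induced subgraph whose complement is a path; lengths count edges (of the complement, for antipaths); the interior is the set of internal vertices. $X$ is anticonnected if $\overline{G}|X$ is connected; $X$ complete to $Y$ means every vertex of $X$ is adjacent to every vertex of $Y$; a vertex is $X$-complete if adjacent to all of $X$. For disjoint $A,B$, the pair $(A,B)$ is balanced if there is no odd path between nonadjacent vertices of $B$ with interior in $A$ and no odd antipath between adjacent vertices of $A$ with interior in $B$. -}

module Defs where

open import Level using (0ℓ)
open import Data.Fin using (Fin; toℕ)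
open import Data.Fin.Properties using (_≟_)
open import Data.Fin.Subset using (Subset; _∈_; ⁅_⁆; ⋃)
open import Data.List using (map)
open import Data.Nat using (ℕ; suc; _≤_; _<_; parity)
open import Data.Parity using (0ℙ; 1ℙ)
open import Data.Product using (_×_; _,_; Σ)
open import Data.Sum using (_⊎_)
open import Data.Vec using (Vec; lookup; head; last; toList)
open import Function.Bundles using (_⇔_)
open import Function.Definitions using (Injective)
open import Relation.Binary.Core using (Rel)
open import Relation.Binary.Construct.Closure.ReflexiveTransitive using (Star)
open import Relation.Binary.Definitions using (Decidable; Symmetric; Irreflexive)
open import Relation.Binary.PropositionalEquality using (_≡_; _≢_; sym)
open import Relation.Nullary using (¬_)
open import Relation.Nullary.Decidable using (¬?; _×-dec_)

Even Odd : ℕ → Set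
Even m = parity m ≡ 0ℙ
Odd  m = parity m ≡ 1ℙ

record Graph (v : ℕ) : Set₁ where
  field
    Adj    : Rel (Fin v) 0ℓ
    adj?   : Decidable Adj
    symm   : Symmetric Adj
    irrefl : Irreflexive _≡_ Adj

open Graph public using (Adj)

complement : ∀ {v} → Graph v → Graph v
complement G = record
  { Adj    = λ u w → u ≢ w × ¬ Adj G u w
  ; adj?   = λ u w → ¬? (u ≟ w) ×-dec ¬? (Graph.adj? G u w)
  ; symm   = λ (u≢w , ¬uw) → (λ w≡u → u≢w (sym w≡u)) , (λ wu → ¬uw (Graph.symm G wu))
  ; irrefl = λ u≡w (u≢w , _) → u≢w u≡w
  }

-- The vertices listed in us are distinct, and the subgraph they induce has
-- edge relation R on their positions.  Injectivity does not follow from the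
-- adjacency condition: u, w, u would otherwise induce a path of length 2.
Induces : ∀ {v k} → Graph v → Rel (Fin k) 0ℓ → Vec (Fin v) k → Set
Induces G R us =
  Injective _≡_ _≡_ (lookup us) ×
  (∀ i j → Adj G (lookup us i) (lookup us j) ⇔ R i j)

PathAdj : ∀ {k} → Rel (Fin k) 0ℓ
PathAdj i j = suc (toℕ i) ≡ toℕ j ⊎ suc (toℕ j) ≡ toℕ i

CyclicSuc : ∀ {k} → Rel (Fin k) 0ℓ
CyclicSuc {k} i j = suc (toℕ i) ≡ toℕ j ⊎ (suc (toℕ i) ≡ k × toℕ j ≡ 0)

CycleAdj : ∀ {k} → Rel (Fin k) 0ℓ
CycleAdj i j = CyclicSuc i j ⊎ CyclicSuc j i

-- Length m means m edges, hence m + 1 vertices; a path is never null.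
IsPath : ∀ {v m} → Graph v → Vec (Fin v) (suc m) → Set
IsPath G us = Induces G PathAdj us

IsAntipath : ∀ {v m} → Graph v → Vec (Fin v) (suc m) → Set
IsAntipath G = IsPath (complement G)

IsHole : ∀ {v k} → Graph v → Vec (Fin v) k → Set
IsHole {k = k} G us = 4 ≤ k × Induces G CycleAdj us

IsAntihole : ∀ {v k} → Graph v → Vec (Fin v) k → Set
IsAntihole G = IsHole (complement G)

Berge : ∀ {v} → Graph v → Set
Berge {v} G =
  (∀ {k} (us : Vec (Fin v) k) → IsHole G us → Even k) ×
  (∀ {k} (us : Vec (Fin v) k) → IsAntihole G us → Even k)

-- Every two vertices of X are joined by a walk all of whose vertices lie in X.
Connected : ∀ {v} → Graph v → Subset v → Set
Connected G X = ∀ {u w} → u ∈ X → w ∈ X →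
  Star (λ a b → a ∈ X × b ∈ X × Adj G a b) u w

Anticonnected : ∀ {v} → Graph v → Subset v → Set
Anticonnected G = Connected (complement G)

VertexComplete : ∀ {v} → Graph v → Subset v → Fin v → Set
VertexComplete G X a = ∀ {x} → x ∈ X → Adj G a x

CompleteTo : ∀ {v} → Graph v → Subset v → Subset v → Set
CompleteTo G X Y = ∀ {x y} → x ∈ X → y ∈ Y → Adj G x y

vertices : ∀ {v k} → Vec (Fin v) k → Subset v
vertices us = ⋃ (map ⁅_⁆ (toList us))

UniqueComplete : ∀ {v k} → Graph v → Subset v → Vec (Fin v) k → Fin v → Set
UniqueComplete G X us a =
  a ∈ vertices us × VertexComplete G X a ×
  (∀ {b} → b ∈ vertices us → VertexComplete G X b → b ≡ a)

InteriorIn : ∀ {v m} → Subset v → Vec (Fin v) (suc m) → Set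
InteriorIn {m = m} A us = ∀ i → 0 < toℕ i → toℕ i < m → lookup us i ∈ A

PathBetween : ∀ {v} → Graph v → Subset v → Fin v → Fin v → ℕ → Set
PathBetween {v} G A a b m = Σ (Vec (Fin v) (suc m)) λ us →
  IsPath G us × head us ≡ a × last us ≡ b × InteriorIn A us

AntipathBetween : ∀ {v} → Graph v → Subset v → Fin v → Fin v → ℕ → Set
AntipathBetween {v} G A a b m = Σ (Vec (Fin v) (suc m)) λ us →
  IsAntipath G us × head us ≡ a × last us ≡ b × InteriorIn A us

-- Meant for disjoint A and B; disjointness is left to the context of use.
Balanced : ∀ {v} → Graph v → Subset v → Subset v → Set
Balanced G A B =
  (∀ {b b′ m} → b ∈ B → b′ ∈ B → ¬ Adj G b b′ → Odd m → ¬ PathBetween G A b b′ m) ×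
  (∀ {a a′ m} → a ∈ A → a′ ∈ A → Adj G a a′ → Odd m → ¬ AntipathBetween G B a a′ m)

{-# OPTIONS --safe #-}

-- Induction on |X| + |Y|.  Call T bad on a segment of P if that segment and T are not balanced.
-- When P has length 2, antipaths Q through X and R through Y close up to an antihole with
-- |Q| + |R| + 1 vertices, so |Q| and |R| differ in parity.  When P is longer, no proper segment
-- is bad for X or for Y: p₁, pₙ or a smaller instance turns such a segment into an odd hole or
-- antihole.  Suppose then that X and Y are not bad on the segments required by the theorem.
-- If |X| = |Y| = 1, there is an odd hole.  Otherwise, by symmetry |X| ≥ 2; write X = U ∪ W with
-- smaller anticonnected U and W.  By induction, consecutive U-complete vertices of P are adjacent
-- or at even distance, the last U-complete vertex is pₙ or at odd distance from it, and the same
-- holds for W.  If switches between U-complete and W-complete vertices are also even, scanning P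
-- shows that the smaller of the two last positions is at even distance from p₁: a contradiction.
-- Suitable U and W exist unless X contains vertices x, y joined by an even antipath, and in that
-- case every (X \ x)-complete vertex but p₁ is adjacent to every such (X \ y)-complete one: absurd too.
module Submission where

open import Defs
open import Data.Empty using (⊥; ⊥-elim)
open import Data.Fin using (Fin; zero; suc; toℕ; fromℕ<)
import Data.Fin.Properties as Finₚ
open import Data.Fin.Properties using (toℕ-injective; toℕ<n; toℕ-fromℕ<; all?) renaming (_≟_ to _≟ᶠ_)
open import Data.Fin.Subset using (Subset; _∈_; _∉_; _⊆_; _∩_; _∪_; _-_; ∁; Empty; Nonempty)
open import Data.Fin.Subset.Properties using (_∈?_; x∈p∪q⁺; x∈⁅x⁆; x∈∁p⇒x∉p; x∈p∧x≢y⇒x∈p-y)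
open import Data.List using (List; []; _∷_; length; filter; allFin)
open import Data.List.Membership.Propositional using (find; lose) renaming (_∈_ to _∈ˡ_; _∉_ to _∉ˡ_)
open import Data.List.Membership.Propositional.Properties using (∈-filter⁺; ∈-filter⁻; ∈-allFin)
open import Data.List.Properties using (filter-notAll)
open import Data.List.Relation.Binary.Subset.Propositional using () renaming (_⊆_ to _⊆ˡ_)
open import Data.List.Relation.Unary.All using (All; []; _∷_)
import Data.List.Relation.Unary.All as All
open import Data.List.Relation.Unary.All.Properties using (¬All⇒Any¬; anti-mono)
open import Data.List.Relation.Unary.Any using (here; there; any?)
open import Data.Nat using (ℕ; zero; suc; pred; _+_; _∸_; _≤_; _<_; z≤n; s≤s; s≤s⁻¹; z<s; parity)
open import Data.Nat.Properties
open import Data.Parity using (Parity; 0ℙ; 1ℙ; _⁻¹)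
import Data.Parity.Base as ℙ
import Data.Parity.Properties as ℙₚ
open import Data.Product using (Σ; _×_; _,_; proj₁; proj₂; ∃; ∃₂)
open import Data.Sum using (_⊎_; inj₁; inj₂; [_,_]′)
open import Data.Vec using (Vec; []; _∷_; _∷ʳ_; head; tail; init; last; lookup; tabulate)
open import Data.Vec.Properties using (last-∷ʳ; lookup∘tabulate)
open import Function using (_∘_)
open import Function.Bundles using (mk⇔; Equivalence)
open import Function.Definitions using (Injective)
open import Level using (0ℓ)
open import Relation.Binary.Construct.Closure.ReflexiveTransitive using (Star; ε; _◅_)
open import Relation.Binary.Core using (Rel)
open import Relation.Binary.Definitions using (Symmetric; tri<; tri≈; tri>)
open import Relation.Binary.PropositionalEquality
  using (_≡_; _≢_; refl; sym; trans; cong; subst; subst₂; ≢-sym)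
open import Relation.Nullary using (¬_; Dec; yes; no; contradiction)
import Relation.Nullary.Decidable as Dec
open import Relation.Nullary.Decidable using (¬?; _⊎-dec_; _×-dec_; _→-dec_; decidable-stable)
import Relation.Unary as U

-- The theorem asks for explicit witnesses, but the induction is run on a refutation: the absence of
-- bad segments is a hypothesis that can be handed on to smaller instances, and a finite search
-- recovers the witnesses at the end. The sets of a smaller instance need not come from X and Y
-- alone: ({p_i}, U), (U, Y) and (Y, {x}) all occur, on segments of P or on a new path through a
-- vertex of X. Hence the measure |X| + |Y| and a claim about arbitrary sequences and segments. A
-- singleton is never bad, so the first and the last kind leave one hypothesis to verify. How X is
-- split depends on whether it is stable in G. If it is, one vertex is set against all others, and
-- every switch between neighbours of two single vertices is a leap. If not, X has adjacent vertices
-- x and y either of which can be deleted without destroying anticonnectedness; U is X without x and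
-- W is X without y. An antipath between x and y, prolonged or closed by vertices of P, then yields
-- antiholes, and its parity decides which argument applies.

parity-suc : ∀ n → parity (suc n) ≡ parity n ⁻¹
parity-suc n = sym (trans (cong _⁻¹ (sym (ℙₚ.suc-homo-⁻¹ n))) (ℙₚ.⁻¹-involutive (parity (suc n))))

≢⇒≡⁻¹ : ∀ {a b : Parity} → a ≢ b → a ⁻¹ ≡ b
≢⇒≡⁻¹ {0ℙ} {0ℙ} a≢b = contradiction refl a≢b
≢⇒≡⁻¹ {0ℙ} {1ℙ} a≢b = refl
≢⇒≡⁻¹ {1ℙ} {0ℙ} a≢b = refl
≢⇒≡⁻¹ {1ℙ} {1ℙ} a≢b = contradiction refl a≢b

odd-step : ∀ m n → parity m ≢ parity n → parity (suc m) ≡ parity n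
odd-step m n m≢n = trans (parity-suc m) (≢⇒≡⁻¹ m≢n)

n≢1+n-parity : ∀ n → parity n ≢ parity (suc n)
n≢1+n-parity n eq = ℙₚ.p≢p⁻¹ (parity n) (trans eq (parity-suc n))

even-step : ∀ m n → parity m ≡ parity n → parity (suc m) ≢ parity n
even-step m n m≡n eq = n≢1+n-parity m (trans m≡n (sym eq))

parity-∸ : ∀ {i n} → i ≤ n → parity n ≡ parity (n ∸ i) ℙ.+ parity i
parity-∸ {i} {n} i≤n = trans (cong parity (sym (m∸n+n≡m i≤n))) (ℙₚ.+-homo-+ (n ∸ i) i)

parity-reflect : ∀ {i j n} → i ≤ n → j ≤ n → parity (n ∸ i) ≡ parity (n ∸ j) → parity i ≡ parity j
parity-reflect {i} {j} {n} i≤n j≤n eq =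
  ℙₚ.+-cancelˡ-≡ (parity (n ∸ i)) (parity i) (parity j)
    (trans (sym (parity-∸ i≤n)) (trans (parity-∸ j≤n) (cong (ℙ._+ parity j) (sym eq))))

odd-∸ : ∀ {i j} → i ≤ j → parity i ≢ parity j → Odd (j ∸ i)
odd-∸ {i} {j} i≤j i≢j with parity (j ∸ i) in eq
... | 1ℙ = refl
... | 0ℙ = contradiction (sym (trans (parity-∸ i≤j) (cong (ℙ._+ parity i) eq))) i≢j

odd≢even : ∀ {m} → Odd m → Even m → ⊥
odd≢even odd even with () ← trans (sym odd) even

odd-suc : ∀ n → Even n → Odd (suc n)
odd-suc n even = trans (parity-suc n) (cong _⁻¹ even)

even-suc : ∀ n → Odd n → Even (suc n)
even-suc n odd = trans (parity-suc n) (cong _⁻¹ odd)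

-- Paths and odd holes

infixr 5 _◂_
_◂_ : ∀ {A : Set} → A → (ℕ → A) → ℕ → A
(x ◂ p) zero    = x
(x ◂ p) (suc i) = p i

module _ {v : ℕ} where

  -- The sequence is total on ℕ and only positions `s` to `t` matter, so a segment of a path is the
  -- same sequence with other bounds and parities of positions keep their meaning.
  record Path (H : Graph v) (p : ℕ → Fin v) (s t : ℕ) : Set where
    field
      distinct  : ∀ {i j} → s ≤ i → i < j → j ≤ t → p i ≢ p j
      edge      : ∀ {i} → s ≤ i → i < t → Adj H (p i) (p (suc i))
      chordless : ∀ {i j} → s ≤ i → suc i < j → j ≤ t → ¬ Adj H (p i) (p j)

    distinct′ : ∀ {i j} → s ≤ i → i ≤ t → s ≤ j → j ≤ t → i ≢ j → p i ≢ p j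
    distinct′ {i} {j} s≤i i≤t s≤j j≤t i≢j with <-cmp i j
    ... | tri< i<j _ _ = distinct s≤i i<j j≤t
    ... | tri≈ _ i≡j _ = contradiction i≡j i≢j
    ... | tri> _ _ j<i = ≢-sym (distinct s≤j j<i i≤t)

    adjacent⇒consecutive : ∀ {i j} → s ≤ i → i < j → j ≤ t → Adj H (p i) (p j) → suc i ≡ j
    adjacent⇒consecutive {i} {j} s≤i i<j j≤t ij with m≤n⇒m<n∨m≡n i<j
    ... | inj₂ 1+i≡j = 1+i≡j
    ... | inj₁ 1+i<j = contradiction ij (chordless s≤i 1+i<j j≤t)

    chordless′ : ∀ {i j} → s ≤ i → suc i < j → j ≤ t → ¬ Adj H (p j) (p i)
    chordless′ s≤i 1+i<j j≤t ji = chordless s≤i 1+i<j j≤t (Graph.symm H ji)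

  open Path public

  module _ (H : Graph v) where

    -- Adjacency and `R` are both symmetric and loopless, so checking increasing pairs of positions
    -- is enough.
    induces : ∀ {k} {R : Rel (Fin k) 0ℓ} (us : Vec (Fin v) k) (q : ℕ → Fin v) →
      (∀ i → lookup us i ≡ q (toℕ i)) → Symmetric R → (∀ i → ¬ R i i) →
      (∀ {i j : Fin k} → toℕ i < toℕ j → q (toℕ i) ≢ q (toℕ j)) →
      (∀ {i j : Fin k} → toℕ i < toℕ j → Adj H (q (toℕ i)) (q (toℕ j)) → R i j) →
      (∀ {i j : Fin k} → toℕ i < toℕ j → R i j → Adj H (q (toℕ i)) (q (toℕ j))) →
      Induces H R us
    induces {k} {R} us q us≗q R-sym R-irrefl inj to from = injective , λ i j → mk⇔ (to′ i j) (from′ i j)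
      where
      injective : ∀ {i j} → lookup us i ≡ lookup us j → i ≡ j
      injective {i} {j} eq with <-cmp (toℕ i) (toℕ j)
      ... | tri< i<j _ _ = contradiction (trans (sym (us≗q i)) (trans eq (us≗q j))) (inj i<j)
      ... | tri≈ _ i≡j _ = toℕ-injective i≡j
      ... | tri> _ _ j<i = contradiction (trans (sym (us≗q j)) (trans (sym eq) (us≗q i))) (inj j<i)
      to′ : ∀ i j → Adj H (lookup us i) (lookup us j) → R i j
      to′ i j ij with <-cmp (toℕ i) (toℕ j)
      ... | tri< i<j _ _ = to i<j (subst₂ (Adj H) (us≗q i) (us≗q j) ij)
      ... | tri≈ _ i≡j _ = contradiction ij (Graph.irrefl H (cong (lookup us) (toℕ-injective i≡j)))
      ... | tri> _ _ j<i = R-sym (to j<i (subst₂ (Adj H) (us≗q j) (us≗q i) (Graph.symm H ij)))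
      from′ : ∀ i j → R i j → Adj H (lookup us i) (lookup us j)
      from′ i j ij with <-cmp (toℕ i) (toℕ j)
      ... | tri< i<j _ _ = subst₂ (Adj H) (sym (us≗q i)) (sym (us≗q j)) (from i<j ij)
      ... | tri≈ _ i≡j _ = contradiction (subst (R i) (sym (toℕ-injective i≡j)) ij) (R-irrefl i)
      ... | tri> _ _ j<i = Graph.symm H (subst₂ (Adj H) (sym (us≗q j)) (sym (us≗q i)) (from j<i (R-sym ij)))

    path⇒isPath : ∀ {m p} (us : Vec (Fin v) (suc m)) → (∀ i → lookup us i ≡ p (toℕ i)) →
      Path H p 0 m → IsPath H us
    path⇒isPath {m} {p} us us≗p P = induces us p us≗p R-sym R-irrefl
      (λ {_} {j} i<j → distinct P z≤n i<j (s≤s⁻¹ (toℕ<n j)))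
      (λ {_} {j} i<j ij → inj₁ (adjacent⇒consecutive P z≤n i<j (s≤s⁻¹ (toℕ<n j)) ij))
      from
      where
      R-sym : Symmetric PathAdj
      R-sym (inj₁ e) = inj₂ e
      R-sym (inj₂ e) = inj₁ e
      R-irrefl : ∀ {k} (i : Fin k) → ¬ PathAdj i i
      R-irrefl i (inj₁ e) = 1+n≢n e
      R-irrefl i (inj₂ e) = 1+n≢n e
      from : ∀ {i j : Fin (suc m)} → toℕ i < toℕ j → PathAdj i j → Adj H (p (toℕ i)) (p (toℕ j))
      from {i} {j} i<j (inj₁ e) = subst (Adj H (p (toℕ i)) ∘ p) e (edge P z≤n (≤-trans i<j (s≤s⁻¹ (toℕ<n j))))
      from {i} {j} i<j (inj₂ e) = contradiction (subst (toℕ j <_) e ≤-refl) (<-asym i<j)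

    NoOddHole : Set
    NoOddHole = ∀ {k} (us : Vec (Fin v) k) → IsHole H us → Even k

    -- Distinctness of w from the path is automatic: a path of length at least 3 has no
    -- vertex adjacent to both of its ends.
    no-odd-cycle : NoOddHole → ∀ {m p w} → Path H p 0 m → 2 ≤ m → Odd m →
      Adj H w (p 0) → Adj H w (p m) → (∀ {i} → 0 < i → i < m → ¬ Adj H w (p i)) → ⊥
    no-odd-cycle noh {suc zero} P (s≤s ()) _
    no-odd-cycle noh {suc (suc zero)} P _ ()
    no-odd-cycle noh {suc (suc (suc m′))} {p} {w} P _ odd w-first w-last w-inner =
      -- The hole consists of `w` and the m + 1 vertices of the path; `parity (2 + m)` reduces to
      -- `parity m`.
      odd≢even {m = 3 + m′} odd (noh us (s≤s (s≤s (s≤s (s≤s z≤n))) ,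
        induces us (w ◂ p) us≗ R-sym R-irrefl dist to from))
      where
      m = 3 + m′
      us : Vec (Fin v) (2 + m)
      us = tabulate ((w ◂ p) ∘ toℕ)
      us≗ : ∀ i → lookup us i ≡ (w ◂ p) (toℕ i)
      us≗ = lookup∘tabulate ((w ◂ p) ∘ toℕ)
      R-sym : Symmetric (CycleAdj {2 + m})
      R-sym (inj₁ e) = inj₂ e
      R-sym (inj₂ e) = inj₁ e
      no-loop : ∀ (i : Fin (2 + m)) → ¬ CyclicSuc i i
      no-loop i (inj₁ e) = 1+n≢n e
      no-loop i (inj₂ (e , e′)) with () ← trans (sym (cong suc e′)) e
      R-irrefl : ∀ (i : Fin (2 + m)) → ¬ CycleAdj i i
      R-irrefl i = [ no-loop i , no-loop i ]′
      w∉ : ∀ j → j ≤ m → w ≢ p j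
      w∉ zero    j≤m refl = Graph.irrefl H refl w-first
      w∉ (suc j) j≤m refl with m≤n⇒m<n∨m≡n j≤m
      ... | inj₂ refl = Graph.irrefl H refl w-last
      ... | inj₁ 1+j<m with m≤n⇒m<n∨m≡n 1+j<m
      ...   | inj₂ refl = chordless′ P z≤n (s≤s (s≤s z≤n)) j≤m w-first
      ...   | inj₁ 2+j<m = chordless P z≤n 2+j<m ≤-refl w-last
      dist : ∀ {i j : Fin (2 + m)} → toℕ i < toℕ j → (w ◂ p) (toℕ i) ≢ (w ◂ p) (toℕ j)
      dist {zero}  {suc j} _   = w∉ (toℕ j) (s≤s⁻¹ (toℕ<n j))
      dist {suc i} {suc j} i<j = distinct P z≤n (s≤s⁻¹ i<j) (s≤s⁻¹ (toℕ<n j))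
      to : ∀ {i j : Fin (2 + m)} → toℕ i < toℕ j → Adj H ((w ◂ p) (toℕ i)) ((w ◂ p) (toℕ j)) → CycleAdj i j
      to {zero} {suc j} _ wj with toℕ j in eq
      ... | zero = inj₁ (inj₁ refl)
      ... | suc j′ with m≤n⇒m<n∨m≡n (subst (_≤ m) eq (s≤s⁻¹ (toℕ<n j)))
      ...   | inj₁ j<m = contradiction wj (w-inner z<s j<m)
      ...   | inj₂ refl = inj₂ (inj₂ (refl , refl))
      to {suc i} {suc j} i<j ij =
        inj₁ (inj₁ (cong suc (adjacent⇒consecutive P z≤n (s≤s⁻¹ i<j) (s≤s⁻¹ (toℕ<n j)) ij)))
      from : ∀ {i j : Fin (2 + m)} → toℕ i < toℕ j → CycleAdj i j → Adj H ((w ◂ p) (toℕ i)) ((w ◂ p) (toℕ j))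
      from {zero} {suc j} _ (inj₁ (inj₁ e)) = subst (Adj H w ∘ p) (suc-injective e) w-first
      from {zero} {suc j} _ (inj₂ (inj₂ (e , _))) =
        subst (Adj H w ∘ p) (sym (suc-injective (suc-injective e))) w-last
      from {suc i} {suc j} i<j (inj₁ (inj₁ e)) =
        subst (Adj H (p (toℕ i)) ∘ p) (suc-injective e)
          (edge P z≤n (≤-trans (s≤s⁻¹ i<j) (s≤s⁻¹ (toℕ<n j))))
      from {suc i} {suc j} i<j (inj₂ (inj₁ e)) =
        contradiction (subst (suc (toℕ j) <_) e ≤-refl) (<-asym i<j)

  module _ {H : Graph v} where

    path-sub : ∀ {p s t s′ t′} → s ≤ s′ → t′ ≤ t → Path H p s t → Path H p s′ t′
    path-sub s≤s′ t′≤t P = record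
      { distinct  = λ s≤i i<j j≤t → distinct P (≤-trans s≤s′ s≤i) i<j (≤-trans j≤t t′≤t)
      ; edge      = λ s≤i i<t → edge P (≤-trans s≤s′ s≤i) (≤-trans i<t t′≤t)
      ; chordless = λ s≤i i<j j≤t → chordless P (≤-trans s≤s′ s≤i) i<j (≤-trans j≤t t′≤t)
      }

    path-shift : ∀ {p s t} m → s + m ≤ t → Path H p s t → Path H (λ i → p (s + i)) 0 m
    path-shift {p} {s} m s+m≤t P = record
      { distinct  = λ {i} {j} _ i<j j≤m →
          distinct P (m≤m+n s i) (+-monoʳ-< s i<j) (≤-trans (+-monoʳ-≤ s j≤m) s+m≤t)
      ; edge      = λ {i} _ i<m → subst (Adj H (p (s + i)) ∘ p) (sym (+-suc s i))
          (edge P (m≤m+n s i) (≤-trans (+-monoʳ-< s i<m) s+m≤t))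
      ; chordless = λ {i} {j} _ i<j j≤m →
          chordless P (m≤m+n s i) (subst (_< s + j) (+-suc s i) (+-monoʳ-< s i<j)) (≤-trans (+-monoʳ-≤ s j≤m) s+m≤t)
      }

    path-cons : ∀ {p m x} → Path H p 0 m → Adj H x (p 0) →
      (∀ {i} → 0 < i → i ≤ m → ¬ Adj H x (p i)) → (∀ {i} → i ≤ m → x ≢ p i) → Path H (x ◂ p) 0 (suc m)
    path-cons {p} {m} {x} P x-first x-rest x∉ = record { distinct = d ; edge = e ; chordless = c }
      where
      d : ∀ {i j} → 0 ≤ i → i < j → j ≤ suc m → (x ◂ p) i ≢ (x ◂ p) j
      d {zero}  {suc j} _ _   j≤m = x∉ (s≤s⁻¹ j≤m)
      d {suc i} {suc j} _ i<j j≤m = distinct P z≤n (s≤s⁻¹ i<j) (s≤s⁻¹ j≤m)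
      e : ∀ {i} → 0 ≤ i → i < suc m → Adj H ((x ◂ p) i) ((x ◂ p) (suc i))
      e {zero}  _ _   = x-first
      e {suc i} _ i<m = edge P z≤n (s≤s⁻¹ i<m)
      c : ∀ {i j} → 0 ≤ i → suc i < j → j ≤ suc m → ¬ Adj H ((x ◂ p) i) ((x ◂ p) j)
      c {zero}  {suc j} _ i<j j≤m = x-rest (s≤s⁻¹ i<j) (s≤s⁻¹ j≤m)
      c {suc i} {suc j} _ i<j j≤m = chordless P z≤n (s≤s⁻¹ i<j) (s≤s⁻¹ j≤m)

    path-snoc : ∀ {p q m} → Path H p 0 m → (∀ {i} → i ≤ m → q i ≡ p i) → Adj H (p m) (q (suc m)) →
      (∀ {i} → i < m → ¬ Adj H (p i) (q (suc m))) → (∀ {i} → i ≤ m → p i ≢ q (suc m)) → Path H q 0 (suc m)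
    path-snoc {p} {q} {m} P q≗p last~ rest≁ new = record { distinct = d ; edge = e ; chordless = c }
      where
      d : ∀ {i j} → 0 ≤ i → i < j → j ≤ suc m → q i ≢ q j
      d 0≤i i<j j≤ eq with m≤n⇒m<n∨m≡n j≤
      ... | inj₁ j<   = distinct P 0≤i i<j (s≤s⁻¹ j<)
                          (trans (sym (q≗p (<⇒≤ (<-≤-trans i<j (s≤s⁻¹ j<))))) (trans eq (q≗p (s≤s⁻¹ j<))))
      ... | inj₂ refl = new (s≤s⁻¹ i<j) (trans (sym (q≗p (s≤s⁻¹ i<j))) eq)
      e : ∀ {i} → 0 ≤ i → i < suc m → Adj H (q i) (q (suc i))
      e 0≤i i< with m≤n⇒m<n∨m≡n (s≤s⁻¹ i<)
      ... | inj₁ i<m  = subst₂ (Adj H) (sym (q≗p (<⇒≤ i<m))) (sym (q≗p i<m)) (edge P 0≤i i<m)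
      ... | inj₂ refl = subst (λ z → Adj H z (q (suc m))) (sym (q≗p ≤-refl)) last~
      c : ∀ {i j} → 0 ≤ i → suc i < j → j ≤ suc m → ¬ Adj H (q i) (q j)
      c 0≤i 1+i<j j≤ ij with m≤n⇒m<n∨m≡n j≤
      ... | inj₁ j<   = chordless P 0≤i 1+i<j (s≤s⁻¹ j<)
                          (subst₂ (Adj H) (q≗p (<⇒≤ (<-trans ≤-refl (<-≤-trans 1+i<j (s≤s⁻¹ j<))))) (q≗p (s≤s⁻¹ j<)) ij)
      ... | inj₂ refl = rest≁ (s≤s⁻¹ 1+i<j) (subst (λ z → Adj H z (q (suc m))) (q≗p (<⇒≤ (s≤s⁻¹ 1+i<j))) ij)

    -- The centre of reflection is left free: N = m reverses a path that starts at 0, N = s + t maps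
    -- the interval from s to t to itself, and N = j reads a segment backwards from p_j.
    path-reflect : ∀ {p s t} N s′ t′ → t′ ≤ N → s ≤ N ∸ t′ → N ∸ s′ ≤ t → Path H p s t → Path H (λ i → p (N ∸ i)) s′ t′
    path-reflect {p} {t = t} N s′ t′ t′≤N lo hi P = record
      { distinct  = λ {i} {j} s≤i i<j j≤t → ≢-sym (distinct P (≤-trans lo (∸-monoʳ-≤ N j≤t))
          (∸-monoʳ-< i<j (≤-trans j≤t t′≤N)) (≤-trans (∸-monoʳ-≤ N s≤i) hi))
      ; edge      = λ {i} s≤i i<t → Graph.symm H (subst (λ k → Adj H (p (N ∸ suc i)) (p k))
          (sym (∸-suc′ (≤-trans i<t t′≤N)))
          (edge P (≤-trans lo (∸-monoʳ-≤ N i<t))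
            (subst (_≤ t) (∸-suc′ (≤-trans i<t t′≤N)) (≤-trans (∸-monoʳ-≤ N s≤i) hi))))
      ; chordless = λ {i} {j} s≤i i<j j≤t → chordless′ P (≤-trans lo (∸-monoʳ-≤ N j≤t))
          (subst (suc (N ∸ j) <_) (sym (∸-suc′ (≤-trans (<⇒≤ i<j) (≤-trans j≤t t′≤N)))) (s≤s (∸-monoʳ-< i<j (≤-trans j≤t t′≤N))))
          (≤-trans (∸-monoʳ-≤ N s≤i) hi)
      }
      where
      ∸-suc′ : ∀ {N i} → suc i ≤ N → N ∸ i ≡ suc (N ∸ suc i)
      ∸-suc′ {suc N} {i} (s≤s i≤N) = +-∸-assoc 1 i≤N

    path-rev : ∀ {p m} → Path H p 0 m → Path H (λ i → p (m ∸ i)) 0 m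
    path-rev {m = m} = path-reflect m 0 m ≤-refl z≤n ≤-refl

    path-ext : ∀ {p q s t} → (∀ {i} → s ≤ i → i ≤ t → p i ≡ q i) → Path H p s t → Path H q s t
    path-ext {p} {q} {s} {t} p≗q P = record
      { distinct  = λ s≤i i<j j≤t eq → distinct P s≤i i<j j≤t
          (trans (p≗q s≤i (≤-trans (<⇒≤ i<j) j≤t)) (trans eq (sym (p≗q (≤-trans s≤i (<⇒≤ i<j)) j≤t))))
      ; edge      = λ s≤i i<t → subst₂ (Adj H) (p≗q s≤i (<⇒≤ i<t)) (p≗q (m≤n⇒m≤1+n s≤i) i<t) (edge P s≤i i<t)
      ; chordless = λ s≤i i<j j≤t ij → chordless P s≤i i<j j≤t
          (subst₂ (Adj H) (sym (p≗q s≤i (≤-trans (<⇒≤ (<-trans ≤-refl i<j)) j≤t)))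
            (sym (p≗q (≤-trans s≤i (<⇒≤ (<-trans ≤-refl i<j))) j≤t)) ij)
      }

    singleton-path : ∀ x → Path H (λ _ → x) 0 0
    singleton-path x = record
      { distinct  = λ { _ () z≤n }
      ; edge      = λ { _ () }
      ; chordless = λ { _ () z≤n }
      }

-- Parity along a sequence of positions

record Last (A : ℕ → Set) (s t α : ℕ) : Set where
  constructor mkLast
  field
    lower : s ≤ α
    upper : α ≤ t
    holds : A α
    none  : ∀ {k} → α < k → k ≤ t → ¬ A k

open Last

last-extend : ∀ {A s t α} → Last A s t α → ¬ A (suc t) → Last A s (suc t) α
last-extend {A} {t = t} (mkLast lo hi a none) ¬a = mkLast lo (m≤n⇒m≤1+n hi) a none′
  where
  none′ : ∀ {k} → _ < k → k ≤ suc t → ¬ A k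
  none′ α<k k≤ with m≤n⇒m<n∨m≡n k≤
  ... | inj₁ k<  = none α<k (s≤s⁻¹ k<)
  ... | inj₂ refl = ¬a

last-refl : ∀ {A s t} → s ≤ t → A t → Last A s t t
last-refl s≤t a = mkLast s≤t ≤-refl a (λ t<k k≤t → contradiction k≤t (<⇒≱ t<k))

findLast : ∀ {A : ℕ → Set} → U.Decidable A → ∀ {s t} → s ≤ t → A s → ∃ (Last A s t)
findLast A? {s} {t} s≤t a with m≤n⇒m<n∨m≡n s≤t
... | inj₂ refl = s , last-refl ≤-refl a
findLast A? {s} {suc t} s≤t a | inj₁ s<t with A? (suc t)
... | yes a′ = suc t , last-refl s≤t a′
... | no ¬a′ with α , l ← findLast A? (s≤s⁻¹ s<t) a = α , last-extend l ¬a′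

Gap : (A : ℕ → Set) (i j : ℕ) → Set
Gap A i j = ∀ {k} → i < k → k < j → ¬ A k

Spaced : (A : ℕ → Set) (s t : ℕ) → Set
Spaced A s t = ∀ {i j} → s ≤ i → i < j → j ≤ t → A i → A j → Gap A i j → j ≡ suc i ⊎ parity i ≡ parity j

-- The start s is excluded because the scan begins at a position that is both an A-position and a
-- B-position, and only there do the two overlap.
EvenSwitch : (A B : ℕ → Set) (s t : ℕ) → Set
EvenSwitch A B s t = ∀ {i j} → s < i → i < j → j ≤ t → A i → B j → Gap A i j → Gap B i j → parity i ≡ parity j

Scanned : (A B : ℕ → Set) (s t : ℕ) → Set
Scanned A B s t = ∃₂ λ α β → Last A s t α × Last B s t β ×
  (α ≤ β → parity α ≡ parity s) × (β ≤ α → parity β ≡ parity s)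

scanned-swap : ∀ {A B s t} → Scanned A B s t → Scanned B A s t
scanned-swap (α , β , lα , lβ , f , g) = β , α , lβ , lα , g , f

-- If β ≤ α, the smaller last position is still β. If α < β, then α and t + 1 are consecutive
-- A-positions with β strictly between them, so they are not adjacent and have equal parity. The
-- switch from β to t + 1 is even as well, so β inherits the parity of α, which is that of s.
scan-step : ∀ {A B : ℕ → Set} {s t} → Spaced A s (suc t) → EvenSwitch B A s (suc t) →
  A (suc t) → ¬ B (suc t) → Scanned A B s t → Scanned A B s (suc t)
scan-step {A} {B} {s} {t} spA swBA a ¬b (α , β , lα , lβ , α≤β⇒ , β≤α⇒) =
  suc t , β , last-refl (m≤n⇒m≤1+n (≤-trans (lower lα) (upper lα))) a , last-extend lβ ¬b ,
  (λ 1+t≤β → contradiction (upper lβ) (<⇒≱ 1+t≤β)) , λ _ → β-even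
  where
  β-even : parity β ≡ parity s
  β-even with ≤-<-connex β α
  ... | inj₁ β≤α = β≤α⇒ β≤α
  ... | inj₂ α<β with spA (lower lα) (s≤s (upper lα)) ≤-refl (holds lα) a
                          (λ α<k k<t → none lα α<k (s≤s⁻¹ k<t))
  ...   | inj₁ 1+t≡1+α = contradiction (upper lβ) (<⇒≱ (subst (_< β) (sym (suc-injective 1+t≡1+α)) α<β))
  ...   | inj₂ α≡t = trans (swBA (≤-<-trans (lower lα) α<β) (s≤s (upper lβ)) ≤-refl (holds lβ) a
                          (λ β<k k<t → none lβ β<k (s≤s⁻¹ k<t))
                          (λ β<k k<t → none lα (<-trans α<β β<k) (s≤s⁻¹ k<t)))
                        (trans (sym α≡t) (α≤β⇒ (<⇒≤ α<β)))

-- The invariant of the scan: the smaller of the last A-position and the last B-position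
-- seen so far has the parity of s.
scan : ∀ {A B : ℕ → Set} → U.Decidable A → U.Decidable B → ∀ {s t} → s ≤ t → A s → B s →
  (∀ {k} → s < k → k ≤ t → A k → ¬ B k) → Spaced A s t → Spaced B s t →
  EvenSwitch A B s t → EvenSwitch B A s t → Scanned A B s t
scan A? B? {s} {t} s≤t as bs disj spA spB swAB swBA with m≤n⇒m<n∨m≡n s≤t
... | inj₂ refl = s , s , last-refl ≤-refl as , last-refl ≤-refl bs , (λ _ → refl) , (λ _ → refl)
scan {A} {B} A? B? {s} {suc t} s≤t as bs disj spA spB swAB swBA | inj₁ s<1+t = step
  where
  up : ∀ {k} → k ≤ t → k ≤ suc t
  up = m≤n⇒m≤1+n
  ih : Scanned A B s t
  ih = scan A? B? (s≤s⁻¹ s<1+t) as bs (λ s<k k≤t → disj s<k (up k≤t))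
    (λ s≤i i<j j≤t → spA s≤i i<j (up j≤t)) (λ s≤i i<j j≤t → spB s≤i i<j (up j≤t))
    (λ s<i i<j j≤t → swAB s<i i<j (up j≤t)) (λ s<i i<j j≤t → swBA s<i i<j (up j≤t))
  step : Scanned A B s (suc t)
  step with A? (suc t) | B? (suc t)
  ... | yes a | yes b = contradiction b (disj s<1+t ≤-refl a)
  ... | yes a | no ¬b = scan-step spA swBA a ¬b ih
  ... | no ¬a | yes b = scanned-swap (scan-step spB swAB b ¬a (scanned-swap ih))
  ... | no ¬a | no ¬b with α , β , lα , lβ , rest ← ih = α , β , last-extend lα ¬a , last-extend lβ ¬b , rest

-- Concatenation of paths

split-at : ∀ a i → i < a ⊎ ∃ λ j → i ≡ a + j
split-at a i with <-≤-connex i a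
... | inj₁ i<a = inj₁ i<a
... | inj₂ a≤i = inj₂ (i ∸ a , sym (m+[n∸m]≡n a≤i))

join : ∀ {A : Set} → ℕ → (ℕ → A) → (ℕ → A) → ℕ → A
join zero    f g = g
join (suc a) f g = f 0 ◂ join a (f ∘ suc) g

join-left : ∀ {A : Set} a (f g : ℕ → A) {i} → i < a → join a f g i ≡ f i
join-left (suc a) f g {zero}  _   = refl
join-left (suc a) f g {suc i} i<a = join-left a (f ∘ suc) g (s≤s⁻¹ i<a)

join-first : ∀ {A : Set} a (f g : ℕ → A) → f a ≡ g 0 → join a f g 0 ≡ f 0
join-first zero    f g eq = sym eq
join-first (suc a) f g eq = refl

join-right : ∀ {A : Set} a (f g : ℕ → A) j → join a f g (a + j) ≡ g j
join-right zero    f g j = refl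
join-right (suc a) f g j = join-right a (f ∘ suc) g j

odd-+ : ∀ m n → parity m ≢ parity n → Odd (m + n)
odd-+ m n m≢n = trans (ℙₚ.+-homo-+ m n) (lemma m≢n)
  where
  lemma : ∀ {a b : Parity} → a ≢ b → a ℙ.+ b ≡ 1ℙ
  lemma {0ℙ} {0ℙ} a≢b = contradiction refl a≢b
  lemma {0ℙ} {1ℙ} a≢b = refl
  lemma {1ℙ} {0ℙ} a≢b = refl
  lemma {1ℙ} {1ℙ} a≢b = contradiction refl a≢b

module _ {v : ℕ} {H : Graph v} where

  join-path : ∀ a {b f g} → Path H f 0 a → Path H g 0 b → f a ≡ g 0 →
    (∀ {i j} → i < a → 0 < j → j ≤ b → ¬ Adj H (f i) (g j)) →
    (∀ {i j} → i < a → 0 < j → j ≤ b → f i ≢ g j) → Path H (join a f g) 0 (a + b)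
  join-path zero    P Q eq ¬adj apart = Q
  join-path (suc a) {b} {f} {g} P Q eq ¬adj apart =
    path-cons (join-path a (path-shift a ≤-refl (path-sub z≤n ≤-refl P)) Q eq (¬adj ∘ s≤s) (apart ∘ s≤s))
      (subst (Adj H (f 0)) (sym (join-first a (f ∘ suc) g eq)) (edge P z≤n z<s)) rest new
    where
    rest : ∀ {i} → 0 < i → i ≤ a + b → ¬ Adj H (f 0) (join a (f ∘ suc) g i)
    rest {i} 0<i i≤ adj with split-at a i
    ... | inj₁ i<a = chordless P z≤n (s≤s 0<i) (m≤n⇒m≤1+n i<a) (subst (Adj H (f 0)) (join-left a (f ∘ suc) g i<a) adj)
    ... | inj₂ (zero  , refl) = chordless P z≤n (s≤s (subst (0 <_) (+-identityʳ a) 0<i)) ≤-refl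
                                  (subst (Adj H (f 0)) (trans (join-right a (f ∘ suc) g 0) (sym eq)) adj)
    ... | inj₂ (suc j , refl) = ¬adj z<s z<s (+-cancelˡ-≤ a _ _ i≤)
                                  (subst (Adj H (f 0)) (join-right a (f ∘ suc) g (suc j)) adj)
    new : ∀ {i} → i ≤ a + b → f 0 ≢ join a (f ∘ suc) g i
    new {i} i≤ eq′ with split-at a i
    ... | inj₁ i<a = distinct P z≤n z<s (m≤n⇒m≤1+n i<a) (trans eq′ (join-left a (f ∘ suc) g i<a))
    ... | inj₂ (zero  , refl) = distinct P z≤n z<s ≤-refl (trans eq′ (trans (join-right a (f ∘ suc) g 0) (sym eq)))
    ... | inj₂ (suc j , refl) = apart z<s z<s (+-cancelˡ-≤ a _ _ i≤) (trans eq′ (join-right a (f ∘ suc) g (suc j)))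

  -- The two paths close up to a hole with a + b vertices. Their common end `f 0` serves as the
  -- vertex outside the path in `no-odd-cycle`; the rest of both paths is joined at the other common
  -- end.
  two-paths : NoOddHole H → ∀ {a b f g} → Path H f 0 a → Path H g 0 b → 2 ≤ a → 2 ≤ b →
    f 0 ≡ g b → f a ≡ g 0 →
    (∀ {i j} → 0 < i → i < a → 0 < j → j < b → ¬ Adj H (f i) (g j)) →
    (∀ {i j} → 0 < i → i < a → 0 < j → j < b → f i ≢ g j) → parity a ≡ parity b
  two-paths noh {suc (suc a)} {suc zero} P Q _ (s≤s ())
  two-paths noh {suc zero} P Q (s≤s ())
  two-paths noh {suc (suc a)} {suc (suc b)} {f} {g} P Q _ _ f₀≡g fa≡g₀ ¬adj apart
    with parity a ℙₚ.≟ parity b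
  ... | yes eq = eq
  ... | no neq = ⊥-elim (no-odd-cycle H noh hPath (s≤s (≤-trans (s≤s z≤n) (m≤n+m (suc b) a)))
        (subst Odd (cong suc (sym (+-suc a b))) (odd-+ a b neq))
        (edge P z≤n z<s)
        (subst₂ (Adj H) (sym f₀≡g) (sym (join-right (suc a) (f ∘ suc) g (suc b)))
          (Graph.symm H (edge Q z≤n ≤-refl)))
        inner)
    where
    h = join (suc a) (f ∘ suc) g
    hPath : Path H h 0 (suc a + suc b)
    hPath = join-path (suc a) (path-shift (suc a) ≤-refl (path-sub z≤n ≤-refl P)) (path-sub z≤n (n≤1+n _) Q) fa≡g₀
      (λ i<a 0<j j≤b → ¬adj z<s (s≤s i<a) 0<j (s≤s j≤b)) (λ i<a 0<j j≤b → apart z<s (s≤s i<a) 0<j (s≤s j≤b))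
    inner : ∀ {i} → 0 < i → i < suc a + suc b → ¬ Adj H (f 0) (h i)
    inner {i} 0<i i< adj with split-at (suc a) i
    ... | inj₁ i<a = chordless P z≤n (s≤s 0<i) (m≤n⇒m≤1+n i<a) (subst (Adj H (f 0)) (join-left (suc a) (f ∘ suc) g i<a) adj)
    ... | inj₂ (j , refl) = chordless′ Q z≤n (s≤s (+-cancelˡ-< (suc a) _ _ i<)) ≤-refl
            (subst₂ (Adj H) f₀≡g (join-right (suc a) (f ∘ suc) g j) adj)

  record Link (S : List (Fin v)) (u w : Fin v) : Set where
    field
      len    : ℕ
      walk   : ℕ → Fin v
      path   : Path H walk 0 len
      start  : walk 0 ≡ u
      finish : walk len ≡ w
      inside : ∀ {i} → i ≤ len → walk i ∈ˡ S

  link-sym : ∀ {S u w} → Link S u w → Link S w u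
  link-sym L = record
    { len    = len
    ; walk   = λ i → walk (len ∸ i)
    ; path   = path-rev path
    ; start  = finish
    ; finish = trans (cong walk (n∸n≡0 len)) start
    ; inside = λ {i} _ → inside (m∸n≤m len i)
    }
    where open Link L

  link-mono : ∀ {S S′ u w} → S ⊆ˡ S′ → Link S u w → Link S′ u w
  link-mono S⊆S′ L = record { Link L ; inside = S⊆S′ ∘ Link.inside L }

  link-refl : ∀ {S u} → u ∈ˡ S → Link S u u
  link-refl {u = u} u∈S = record
    { len = 0 ; walk = λ _ → u ; path = singleton-path u ; start = refl ; finish = refl ; inside = λ _ → u∈S }

  link-cons : ∀ {S x u w} → Adj H x u → Link S u w → Link (x ∷ S) x w
  link-cons {S} {x} x~u L with findLast touches? z≤n first
    where
    open Link L
    touches? = λ i → (x ≟ᶠ walk i) ⊎-dec Graph.adj? H x (walk i)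
    first : x ≡ walk 0 ⊎ Adj H x (walk 0)
    first = inj₂ (subst (Adj H x) (sym start) x~u)
  ... | α , mkLast _ α≤len (inj₁ x≡) none = record
    { len    = len ∸ α
    ; walk   = λ i → walk (α + i)
    ; path   = path-shift (len ∸ α) (≤-reflexive (m+[n∸m]≡n α≤len)) (path-sub z≤n ≤-refl path)
    ; start  = trans (cong walk (+-identityʳ α)) (sym x≡)
    ; finish = trans (cong walk (m+[n∸m]≡n α≤len)) finish
    ; inside = λ {i} i≤ → there (inside (subst (α + i ≤_) (m+[n∸m]≡n α≤len) (+-monoʳ-≤ α i≤)))
    }
    where open Link L
  ... | α , mkLast _ α≤len (inj₂ x~) none = record
    { len    = suc (len ∸ α)
    ; walk   = x ◂ (λ i → walk (α + i))
    ; path   = path-cons (path-shift (len ∸ α) (≤-reflexive (m+[n∸m]≡n α≤len)) (path-sub z≤n ≤-refl path))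
        (subst (Adj H x ∘ walk) (sym (+-identityʳ α)) x~)
        (λ 0<i i≤ x~i → none (m<m+n α 0<i) (bound i≤) (inj₂ x~i))
        new
    ; start  = refl
    ; finish = trans (cong walk (m+[n∸m]≡n α≤len)) finish
    ; inside = λ { {zero} _ → here refl ; {suc i} i≤ → there (inside (bound (s≤s⁻¹ i≤))) }
    }
    where
    open Link L
    bound : ∀ {i} → i ≤ len ∸ α → α + i ≤ len
    bound {i} i≤ = subst (α + i ≤_) (m+[n∸m]≡n α≤len) (+-monoʳ-≤ α i≤)
    new : ∀ {i} → i ≤ len ∸ α → x ≢ walk (α + i)
    new {zero}  i≤ refl = Graph.irrefl H (cong walk (+-identityʳ α)) x~
    new {suc i} i≤ x≡   = none (m<m+n α z<s) (bound i≤) (inj₁ x≡)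

-- Connected sets as lists in order of attachment

module _ {v : ℕ} (H : Graph v) where

  open import Data.List.Membership.DecPropositional (_≟ᶠ_ {v}) using () renaming (_∈?_ to _∈ˡ?_)

  -- Each vertex has a neighbour in the rest of the list, so every nonempty tail is again connected
  -- and the head can always be deleted. Later this is used for the complement graph, where it
  -- describes anticonnected sets.
  data Tree : List (Fin v) → Set where
    root   : ∀ x → Tree (x ∷ [])
    attach : ∀ {x u xs} → x ∉ˡ xs → u ∈ˡ xs → Adj H x u → Tree xs → Tree (x ∷ xs)

  tree-nonempty : ∀ {xs} → Tree xs → ∃ λ x → x ∈ˡ xs
  tree-nonempty (root x)         = x , here refl
  tree-nonempty (attach {x} _ _ _ _) = x , here refl

  tree-link : ∀ {xs u w} → Tree xs → u ∈ˡ xs → w ∈ˡ xs → Link {H = H} xs u w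
  tree-link (root x) (here refl) (here refl) = link-refl (here refl)
  tree-link (attach _ _ _ _) (here refl) (here refl) = link-refl (here refl)
  tree-link (attach _ b∈ x~b T) (here refl) (there w∈) = link-cons x~b (tree-link T b∈ w∈)
  tree-link (attach _ b∈ x~b T) (there u∈) (here refl) = link-sym (link-cons x~b (tree-link T b∈ u∈))
  tree-link (attach _ _ _ T) (there u∈) (there w∈) = link-mono there (tree-link T u∈ w∈)

  record Through (S : List (Fin v)) (x y : Fin v) : Set where
    field
      len    : ℕ
      walk   : ℕ → Fin v
      path   : Path H walk 0 len
      start  : walk 0 ≡ x
      finish : walk len ≡ y
      inner  : ∀ {i} → 0 < i → i < len → walk i ∈ˡ S

  through-sym : ∀ {S x y} → Through S x y → Through S y x
  through-sym L = record
    { len    = len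
    ; walk   = λ i → walk (len ∸ i)
    ; path   = path-rev path
    ; start  = finish
    ; finish = trans (cong walk (n∸n≡0 len)) start
    ; inner  = λ 0<i i<len → inner (m<n⇒0<n∸m i<len) (∸-monoʳ-< 0<i (<⇒≤ i<len))
    }
    where open Through L

  through-mono : ∀ {S S′ x y} → S ⊆ˡ S′ → Through S x y → Through S′ x y
  through-mono S⊆S′ L = record { Through L ; inner = λ 0<i i< → S⊆S′ (Through.inner L 0<i i<) }

  through-cons : ∀ {S a x y} → Adj H a x → a ≢ x → ¬ Adj H a y → a ≢ y →
    (∀ {z} → z ∈ˡ S → ¬ Adj H a z) → a ∉ˡ S → (L : Through S x y) →
    Σ (Through (x ∷ S) a y) λ L′ → Through.len L′ ≡ suc (Through.len L)
  through-cons {S} {a} {x} {y} a~x a≢x a≁y a≢y a≁S a∉S L = record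
    { len    = suc len
    ; walk   = a ◂ walk
    ; path   = path-cons path (subst (Adj H a) (sym start) a~x) rest new
    ; start  = refl
    ; finish = finish
    ; inner  = λ { {suc i} _ i< → inner′ (s≤s⁻¹ i<) }
    } , refl
    where
    open Through L
    rest : ∀ {i} → 0 < i → i ≤ len → ¬ Adj H a (walk i)
    rest 0<i i≤ with m≤n⇒m<n∨m≡n i≤
    ... | inj₁ i<   = a≁S (inner 0<i i<)
    ... | inj₂ refl = subst (λ z → ¬ Adj H a z) (sym finish) a≁y
    new : ∀ {i} → i ≤ len → a ≢ walk i
    new {zero}  _ eq = a≢x (trans eq start)
    new {suc i} i≤ eq with m≤n⇒m<n∨m≡n i≤
    ... | inj₁ i<   = a∉S (subst (_∈ˡ S) (sym eq) (inner z<s i<))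
    ... | inj₂ refl = a≢y (trans eq finish)
    inner′ : ∀ {i} → i < len → walk i ∈ˡ x ∷ S
    inner′ {zero}  _  = here start
    inner′ {suc i} i< = there (inner z<s i<)

  no-odd-through : NoOddHole H → ∀ {S x y z} (L : Through S x y) → 2 ≤ Through.len L → Odd (Through.len L) →
    Adj H z x → Adj H z y → (∀ {u} → u ∈ˡ S → ¬ Adj H z u) → ⊥
  no-odd-through noh {z = z} L 2≤ odd z~x z~y z≁S =
    no-odd-cycle H noh path 2≤ odd (subst (Adj H z) (sym start) z~x) (subst (Adj H z) (sym finish) z~y)
      (λ 0<i i< → z≁S (inner 0<i i<))
    where open Through L

  through-long : ∀ {S x y} → x ≢ y → ¬ Adj H x y → (L : Through S x y) → 2 ≤ Through.len L
  through-long x≢y x≁y record { len = zero ; start = refl ; finish = refl } = contradiction refl x≢y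
  through-long x≢y x≁y record { len = suc zero ; path = path ; start = refl ; finish = refl } =
    contradiction (edge path z≤n z<s) x≁y
  through-long x≢y x≁y record { len = suc (suc _) } = s≤s (s≤s z≤n)

  -- The nonadjacent ends leave room for exactly one interior vertex: two of them would both be c.
  -- So the length is 2.
  no-odd-through-singleton : ∀ {c x y} → x ≢ y → ¬ Adj H x y → (L : Through (c ∷ []) x y) → ¬ Odd (Through.len L)
  no-odd-through-singleton x≢y x≁y L odd with Through.len L in eq | through-long x≢y x≁y L
  ... | suc zero | s≤s ()
  ... | suc (suc zero) | _ with () ← odd
  ... | suc (suc (suc l)) | _ with inner {1} z<s (subst (1 <_) (sym eq) (s≤s z<s)) | inner {2} z<s (subst (2 <_) (sym eq) (s≤s (s≤s z<s)))
    where open Through L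
  ...   | here e | here e′ = distinct path {1} {2} z≤n ≤-refl (subst (2 ≤_) (sym eq) (s≤s (s≤s z≤n))) (trans e (sym e′))
    where open Through L

  tree-through : ∀ {S x y u w} → Tree S → u ∈ˡ S → Adj H x u → w ∈ˡ S → Adj H y w → Through S x y
  tree-through {S} {x} {y} T u∈ x~u w∈ y~w = record
    { len = len ; walk = walk ; path = path ; start = start ; finish = finish ; inner = inner }
    where
    L : Link {H = H} (x ∷ y ∷ S) x y
    L = link-cons x~u (link-sym (link-cons y~w (tree-link T w∈ u∈)))
    open Link L
    -- The link may use x and y, but these already occupy its two ends, so distinctness keeps them
    -- out of the interior.
    inner : ∀ {i} → 0 < i → i < len → walk i ∈ˡ S
    inner 0<i i<len with inside (<⇒≤ i<len)
    ... | here eq         = contradiction (trans start (sym eq)) (distinct path z≤n 0<i (<⇒≤ i<len))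
    ... | there (here eq) = contradiction (trans eq (sym finish)) (distinct path z≤n i<len ≤-refl)
    ... | there (there i∈) = i∈

  Clique : List (Fin v) → Set
  Clique xs = ∀ {u w} → u ∈ˡ xs → w ∈ˡ xs → u ≢ w → Adj H u w

  -- In a clique any order is an order of attachment. This allows a vertex in the middle of the list
  -- to be deleted; repeated entries are dropped along the way.
  clique-tree : ∀ {c} xs → Clique xs → c ∈ˡ xs → ∃ λ ys → Tree ys × ys ⊆ˡ xs × xs ⊆ˡ ys × length ys ≤ length xs
  clique-tree (x ∷ [])     _ _ = x ∷ [] , root x , (λ z → z) , (λ z → z) , ≤-refl
  clique-tree (x ∷ x′ ∷ xs) cl _
    with ys , T , ys⊆ , ⊆ys , short ← clique-tree (x′ ∷ xs) (λ u∈ w∈ → cl (there u∈) (there w∈)) (here refl)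
    with x ∈ˡ? ys
  ... | yes x∈ = ys , T , there ∘ ys⊆ , (λ { (here refl) → x∈ ; (there z∈) → ⊆ys z∈ }) , m≤n⇒m≤1+n short
  ... | no  x∉ = x ∷ ys ,
        attach x∉ (⊆ys (here refl)) (cl (here refl) (there (here refl)) (λ { refl → x∉ (⊆ys (here refl)) })) T ,
        (λ { (here refl) → here refl ; (there z∈) → there (ys⊆ z∈) }) ,
        (λ { (here refl) → here refl ; (there z∈) → there (⊆ys z∈) }) , s≤s short

  -- This certifies that x is not a cut vertex. The length bound is what makes the remainder
  -- available to the induction on sizes.
  record Without (xs : List (Fin v)) (x : Fin v) : Set where
    field
      others  : List (Fin v)
      tree    : Tree others
      shorter : length others < length xs
      covers  : xs ⊆ˡ x ∷ others
      within  : others ⊆ˡ xs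
      removed : x ∉ˡ others

    remaining : ∀ {y} → y ∈ˡ xs → y ≢ x → y ∈ˡ others
    remaining y∈ y≢x with covers y∈
    ... | here y≡x = contradiction y≡x y≢x
    ... | there y∈′ = y∈′

  open Without

  without-root : ∀ {x xs} → x ∉ˡ xs → Tree xs → Without (x ∷ xs) x
  without-root {xs = xs} x∉ T = record
    { others = xs ; tree = T ; shorter = ≤-refl ; covers = λ z → z ; within = there ; removed = x∉ }

  without-attach : ∀ {a xs x u} → a ∉ˡ xs → x ∈ˡ xs → (R : Without xs x) → u ∈ˡ others R → Adj H a u → Without (a ∷ xs) x
  without-attach {a} a∉ x∈ R u∈ a~u = record
    { others  = a ∷ others R
    ; tree    = attach (a∉ ∘ within R) u∈ a~u (tree R)
    ; shorter = s≤s (shorter R)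
    ; covers  = λ { (here refl) → there (here refl) ; (there z∈) → [ here , there ∘ there ]′ (cases (covers R z∈)) }
    ; within  = λ { (here refl) → here refl ; (there z∈) → there (within R z∈) }
    ; removed = λ { (here refl) → a∉ x∈ ; (there x∈′) → removed R x∈′ }
    }
    where
    cases : ∀ {z y ys} → z ∈ˡ y ∷ ys → z ≡ y ⊎ z ∈ˡ ys
    cases (here e)  = inj₁ e
    cases (there e) = inj₂ e

  -- In the second alternative of `kind` the remainder after deleting both x and y is
  -- connected; in the first one x and y have a common neighbour c.
  record Pair (xs : List (Fin v)) : Set where
    field
      x y     : Fin v
      x∈      : x ∈ˡ xs
      y∈      : y ∈ˡ xs
      x≢y     : x ≢ y
      x≁y     : ¬ Adj H x y
      minusX  : Without xs x
      minusY  : Without xs y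
      W       : List (Fin v)
      W-tree  : Tree W
      W-short : length W < length xs
      W⊆x     : W ⊆ˡ others minusX
      W⊆y     : W ⊆ˡ others minusY
      {u w}   : Fin v
      u∈      : u ∈ˡ W
      x~u     : Adj H x u
      w∈      : w ∈ˡ W
      y~w     : Adj H y w
      kind    : (∃ λ c → W ≡ c ∷ []) ⊎ xs ⊆ˡ x ∷ y ∷ W

  pair-swap : ∀ {xs} → Pair xs → Pair xs
  pair-swap {xs} S = record
    { x∈ = y∈ ; y∈ = x∈ ; x≢y = ≢-sym x≢y ; x≁y = x≁y ∘ Graph.symm H
    ; minusX = minusY ; minusY = minusX ; W = W ; W-tree = W-tree ; W-short = W-short
    ; W⊆x = W⊆y ; W⊆y = W⊆x ; u∈ = w∈ ; x~u = y~w ; w∈ = u∈ ; y~w = x~u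
    ; kind = exchange-kind kind
    }
    where
    open Pair S
    exchange : ∀ {z} → z ∈ˡ x ∷ y ∷ W → z ∈ˡ y ∷ x ∷ W
    exchange (here e)          = there (here e)
    exchange (there (here e))  = here e
    exchange (there (there e)) = there (there e)
    exchange-kind : (∃ λ c → W ≡ c ∷ []) ⊎ xs ⊆ˡ x ∷ y ∷ W → (∃ λ c → W ≡ c ∷ []) ⊎ xs ⊆ˡ y ∷ x ∷ W
    exchange-kind (inj₁ e)   = inj₁ e
    exchange-kind (inj₂ cov) = inj₂ (λ z∈ → exchange (cov z∈))

  -- A new vertex a that sees x but not y can replace x.
  pair-hang : ∀ {a xs} → Tree xs → a ∉ˡ xs → (S : Pair xs) → Adj H a (Pair.x S) → ¬ Adj H a (Pair.y S) → Pair (a ∷ xs)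
  pair-hang {a} {xs} T a∉ S a~x a≁y = record
    { x∈ = here refl ; y∈ = there y∈ ; x≢y = λ { refl → a∉ y∈ } ; x≁y = a≁y
    ; minusX = without-root a∉ T ; minusY = without-attach a∉ y∈ minusY x∈Ry a~x
    ; W = others minusY ; W-tree = tree minusY ; W-short = m≤n⇒m≤1+n (shorter minusY)
    ; W⊆x = within minusY ; W⊆y = there
    ; u∈ = x∈Ry ; x~u = a~x ; w∈ = W⊆y w∈ ; y~w = y~w
    ; kind = inj₂ λ { (here refl) → here refl ; (there z∈) → there (covers minusY z∈) }
    }
    where
    open Pair S
    x∈Ry : x ∈ˡ others minusY
    x∈Ry = remaining minusY x∈ x≢y

  -- The new vertex is a common neighbour of x and y, so it alone can serve as `W`. After deleting
  -- one of x and y it hangs on the other.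
  pair-cherry : ∀ {a xs} → a ∉ˡ xs → (S : Pair xs) → Adj H a (Pair.x S) → Adj H a (Pair.y S) → Pair (a ∷ xs)
  pair-cherry {a} {xs} a∉ S a~x a~y = record
    { x∈ = there x∈ ; y∈ = there y∈ ; x≢y = x≢y ; x≁y = x≁y
    ; minusX = without-attach a∉ x∈ minusX (remaining minusX y∈ (≢-sym x≢y)) a~y
    ; minusY = without-attach a∉ y∈ minusY (remaining minusY x∈ x≢y) a~x
    ; W = a ∷ [] ; W-tree = root a ; W-short = s≤s (≤-<-trans z≤n (shorter minusX))
    ; W⊆x = λ { (here refl) → here refl } ; W⊆y = λ { (here refl) → here refl }
    ; u∈ = here refl ; x~u = Graph.symm H a~x ; w∈ = here refl ; y~w = Graph.symm H a~y
    ; kind = inj₁ (a , refl)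
    }
    where open Pair S

  -- When `W` is a single vertex, the old pair survives unless x or y is the only neighbour of a;
  -- then a takes over the role of that vertex. When x, y and `W` exhaust the set, a joins `W` if it
  -- sees `W`; otherwise it sees x or y, and seeing both or just one of them gives a new pair.
  pair-attach : ∀ {a b xs} → Tree xs → a ∉ˡ xs → b ∈ˡ xs → Adj H a b → Pair xs → Pair (a ∷ xs)
  pair-attach {a} {b} {xs} T a∉ b∈ a~b S with Pair.kind S
  ... | inj₁ (c , refl) with any? (Graph.adj? H a) (others (Pair.minusX S)) | any? (Graph.adj? H a) (others (Pair.minusY S))
  ...   | no ¬x | _ with covers (Pair.minusX S) b∈
  ...     | here refl = pair-hang T a∉ S a~b (λ a~y → ¬x (lose (remaining minusX y∈ (≢-sym x≢y)) a~y))
    where open Pair S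
  ...     | there b∈′ = contradiction (lose b∈′ a~b) ¬x
  pair-attach T a∉ b∈ a~b S | inj₁ _ | yes _ | no ¬y with covers (Pair.minusY S) b∈
  ...     | here refl = pair-hang T a∉ (pair-swap S) a~b (λ a~x → ¬y (lose (remaining minusY x∈ x≢y) a~x))
    where open Pair S
  ...     | there b∈′ = contradiction (lose b∈′ a~b) ¬y
  pair-attach {a} T a∉ b∈ a~b S | inj₁ (c , refl) | yes ax | yes ay
    with _ , i∈ , a~i ← find ax | _ , j∈ , a~j ← find ay = record
    { x∈ = there x∈ ; y∈ = there y∈ ; x≢y = x≢y ; x≁y = x≁y
    ; minusX = without-attach a∉ x∈ minusX i∈ a~i ; minusY = without-attach a∉ y∈ minusY j∈ a~j
    ; W = W ; W-tree = W-tree ; W-short = m≤n⇒m≤1+n W-short ; W⊆x = there ∘ W⊆x ; W⊆y = there ∘ W⊆y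
    ; u∈ = u∈ ; x~u = x~u ; w∈ = w∈ ; y~w = y~w
    ; kind = inj₁ (c , refl)
    }
    where open Pair S
  pair-attach {a} T a∉ b∈ a~b S | inj₂ cov with any? (Graph.adj? H a) (Pair.W S)
  ... | yes aw with i , i∈ , a~i ← find aw = record
    { x∈ = there x∈ ; y∈ = there y∈ ; x≢y = x≢y ; x≁y = x≁y
    ; minusX = without-attach a∉ x∈ minusX (W⊆x i∈) a~i ; minusY = without-attach a∉ y∈ minusY (W⊆y i∈) a~i
    ; W = a ∷ W ; W-tree = attach (a∉ ∘ within minusX ∘ W⊆x) i∈ a~i W-tree ; W-short = s≤s W-short
    ; W⊆x = λ { (here refl) → here refl ; (there z∈) → there (W⊆x z∈) }
    ; W⊆y = λ { (here refl) → here refl ; (there z∈) → there (W⊆y z∈) }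
    ; u∈ = there u∈ ; x~u = x~u ; w∈ = there w∈ ; y~w = y~w
    ; kind = inj₂ λ { (here refl) → there (there (here refl)) ; (there z∈) → shuffle (cov z∈) }
    }
    where
    open Pair S
    shuffle : ∀ {z} → z ∈ˡ x ∷ y ∷ W → z ∈ˡ x ∷ y ∷ a ∷ W
    shuffle (here e)          = here e
    shuffle (there (here e))  = there (here e)
    shuffle (there (there e)) = there (there (there e))
  ... | no ¬w with Graph.adj? H a (Pair.x S) | Graph.adj? H a (Pair.y S)
  ...   | yes a~x | yes a~y = pair-cherry a∉ S a~x a~y
  ...   | yes a~x | no  a≁y = pair-hang T a∉ S a~x a≁y
  ...   | no  a≁x | yes a~y = pair-hang T a∉ (pair-swap S) a~y a≁x
  ...   | no  a≁x | no  a≁y with cov b∈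
  ...     | here refl         = contradiction a~b a≁x
  ...     | there (here refl) = contradiction a~b a≁y
  ...     | there (there b∈W) = contradiction (lose b∈W a~b) ¬w

  -- Applied to the complement of G, the first alternative says that the set is stable in G, and the
  -- second provides adjacent vertices of G whose separate deletions keep it anticonnected.
  clique-or-pair : ∀ {xs} → Tree xs → Clique xs ⊎ Pair xs
  clique-or-pair (root x) = inj₁ λ { (here refl) (here refl) u≢w → contradiction refl u≢w }
  clique-or-pair (attach {a} {u} {xs} a∉ u∈ a~u T) with clique-or-pair T
  ... | inj₂ S = inj₂ (pair-attach T a∉ u∈ a~u S)
  ... | inj₁ cl with any? (λ b → ¬? (Graph.adj? H a b)) xs
  ...   | no none = inj₁ λ
      { (here refl) (here refl) u≢w → contradiction refl u≢w
      ; (here refl) (there w∈)  _   → adj w∈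
      ; (there u∈)  (here refl) _   → Graph.symm H (adj u∈)
      ; (there u∈)  (there w∈)  u≢w → cl u∈ w∈ u≢w }
    where
    adj : ∀ {w} → w ∈ˡ xs → Adj H a w
    adj {w} w∈ with Graph.adj? H a w
    ... | yes a~w = a~w
    ... | no  a≁w = contradiction (lose w∈ a≁w) none
  ...   | yes some with b , b∈ , a≁b ← find some = inj₂ record
    { x∈ = here refl ; y∈ = there b∈ ; x≢y = λ { refl → a∉ b∈ } ; x≁y = a≁b
    ; minusX = without-root a∉ T ; minusY = without-attach a∉ b∈ minus (remaining minus u∈ u≢b) a~u
    ; W = u ∷ [] ; W-tree = root u ; W-short = s≤s (≤-<-trans z≤n (shorter minus))
    ; W⊆x = λ { (here refl) → u∈ } ; W⊆y = λ { (here refl) → there (remaining minus u∈ u≢b) }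
    ; u∈ = here refl ; x~u = a~u ; w∈ = here refl ; y~w = cl b∈ u∈ (≢-sym u≢b)
    ; kind = inj₁ (u , refl)
    }
    where
    u≢b : u ≢ b
    u≢b refl = a≁b a~u
    ≢b? = λ z → ¬? (z ≟ᶠ b)
    minus : Without xs b
    minus with ys , T′ , ys⊆ , ⊆ys , short ← clique-tree (filter ≢b? xs)
                 (λ u∈ w∈ → cl (proj₁ (∈-filter⁻ ≢b? u∈)) (proj₁ (∈-filter⁻ ≢b? w∈)))
                 (∈-filter⁺ ≢b? u∈ u≢b) = record
      { others  = ys
      ; tree    = T′
      ; shorter = ≤-<-trans short (filter-notAll ≢b? xs (lose b∈ (λ b≢b → b≢b refl)))
      ; covers  = cov
      ; within  = λ z∈ → proj₁ (∈-filter⁻ ≢b? (ys⊆ z∈))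
      ; removed = λ b∈ys → proj₂ (∈-filter⁻ ≢b? {xs = xs} (ys⊆ b∈ys)) refl
      }
      where
      cov : xs ⊆ˡ b ∷ ys
      cov {z} z∈ with z ≟ᶠ b
      ... | yes z≡b = here z≡b
      ... | no  z≢b = there (⊆ys (∈-filter⁺ ≢b? z∈ z≢b))

-- Reflection of positions; vectors read as sequences

∸-lower : ∀ s t {k} → k ≤ t → s ≤ s + t ∸ k
∸-lower s t {k} k≤t = subst (_≤ s + t ∸ k) (m+n∸n≡m s t) (∸-monoʳ-≤ (s + t) k≤t)

∸-upper : ∀ s t {k} → s ≤ k → s + t ∸ k ≤ t
∸-upper s t {k} s≤k = subst (s + t ∸ k ≤_) (m+n∸m≡n s t) (∸-monoʳ-≤ (s + t) s≤k)

∸-upper-< : ∀ s t {k} → s < k → k ≤ t → s + t ∸ k < t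
∸-upper-< s t {k} s<k k≤t = subst (s + t ∸ k <_) (m+n∸m≡n s t) (∸-monoʳ-< s<k (≤-trans k≤t (m≤n+m t s)))

∸-lower-< : ∀ s t {k} → k < t → s < s + t ∸ k
∸-lower-< s t {k} k<t = subst (_< s + t ∸ k) (m+n∸n≡m s t) (∸-monoʳ-< k<t (m≤n+m t s))

m∸n≡1+[m∸1+n] : ∀ {m n} → n < m → m ∸ n ≡ suc (m ∸ suc n)
m∸n≡1+[m∸1+n] {suc m} {n} (s≤s n≤m) = +-∸-assoc 1 n≤m

1<1+length : ∀ {A : Set} {x : A} {xs} → x ∈ˡ xs → 1 < suc (length xs)
1<1+length (here _)  = s≤s z<s
1<1+length (there _) = s≤s z<s

pred-< : ∀ {s t} → s < t → pred t < t
pred-< {t = suc t} _ = ≤-refl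

gap-reflect : ∀ {i j N} (A : ℕ → Set) → i < j → j ≤ N → Gap A i j → Gap (λ k → A (N ∸ k)) (N ∸ j) (N ∸ i)
gap-reflect {i} {j} {N} A i<j j≤N gap {k} lo< <hi =
  gap (subst (_< N ∸ k) (m∸[m∸n]≡n (≤-trans (<⇒≤ i<j) j≤N)) (∸-monoʳ-< <hi (m∸n≤m N i)))
      (subst (N ∸ k <_) (m∸[m∸n]≡n j≤N) (∸-monoʳ-< lo< (≤-trans (<⇒≤ <hi) (m∸n≤m N i))))

gap-unreflect : ∀ {i j N} (A : ℕ → Set) → i < j → j ≤ N → Gap (λ k → A (N ∸ k)) i j → Gap A (N ∸ j) (N ∸ i)
gap-unreflect {i} {j} {N} A i<j j≤N gap lo< <hi a =
  gap-reflect (λ k → A (N ∸ k)) i<j j≤N gap lo< <hi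
    (subst A (sym (m∸[m∸n]≡n (≤-trans (<⇒≤ <hi) (m∸n≤m N i)))) a)

-- Positions past the end of the vector give its last entry.
at : ∀ {A : Set} {n} → Vec A (suc n) → ℕ → A
at (x ∷ _)      zero    = x
at (x ∷ [])     (suc _) = x
at (x ∷ y ∷ ys) (suc i) = at (y ∷ ys) i

lookup-at : ∀ {A : Set} {n} (us : Vec A (suc n)) i → lookup us i ≡ at us (toℕ i)
lookup-at (x ∷ [])     zero    = refl
lookup-at (x ∷ y ∷ ys) zero    = refl
lookup-at (x ∷ y ∷ ys) (suc i) = lookup-at (y ∷ ys) i

at-lookup : ∀ {A : Set} {n} (us : Vec A (suc n)) {i} (i≤n : i ≤ n) → at us i ≡ lookup us (fromℕ< (s≤s i≤n))
at-lookup us i≤n = trans (cong (at us) (sym (toℕ-fromℕ< (s≤s i≤n)))) (sym (lookup-at us (fromℕ< (s≤s i≤n))))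

at-last : ∀ {A : Set} {n} (us : Vec A (suc n)) → at us n ≡ last us
at-last (x ∷ [])     = refl
at-last (x ∷ y ∷ ys) = at-last (y ∷ ys)

at-∷ʳ : ∀ {A : Set} {n} (us : Vec A (suc n)) x {i} → i ≤ n → at (us ∷ʳ x) i ≡ at us i
at-∷ʳ (y ∷ [])     x {zero}  _   = refl
at-∷ʳ (y ∷ z ∷ us) x {zero}  _   = refl
at-∷ʳ (y ∷ z ∷ us) x {suc i} i≤n = at-∷ʳ (z ∷ us) x (s≤s⁻¹ i≤n)

at-init : ∀ {A : Set} {n} (us : Vec A (suc (suc n))) {i} → i ≤ n → at (init us) i ≡ at us i
at-init (x ∷ y ∷ [])     {zero}  _   = refl
at-init (x ∷ y ∷ z ∷ us) {zero}  _   = refl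
at-init (x ∷ y ∷ z ∷ us) {suc i} i≤n = at-init (y ∷ z ∷ us) (s≤s⁻¹ i≤n)

last-≗ : ∀ {A : Set} {n} (us : Vec A (suc n)) q → (∀ i → lookup us i ≡ q (toℕ i)) → last us ≡ q n
last-≗ us q us≗q = trans (sym (at-last us)) (trans (at-lookup us ≤-refl)
  (trans (us≗q (fromℕ< ≤-refl)) (cong q (toℕ-fromℕ< ≤-refl))))

∈-vertices⁺ : ∀ {v n} (us : Vec (Fin v) n) i → lookup us i ∈ vertices us
∈-vertices⁺ (x ∷ us) zero    = x∈p∪q⁺ (inj₁ (x∈⁅x⁆ x))
∈-vertices⁺ (x ∷ us) (suc i) = x∈p∪q⁺ (inj₂ (∈-vertices⁺ us i))

at∈vertices : ∀ {v n} (us : Vec (Fin v) (suc n)) {i} → i ≤ n → at us i ∈ vertices us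
at∈vertices us i≤n = subst (_∈ vertices us) (sym (at-lookup us i≤n)) (∈-vertices⁺ us _)

isPath⇒path : ∀ {v m} {H : Graph v} (us : Vec (Fin v) (suc m)) → IsPath H us → Path H (at us) 0 m
isPath⇒path {v} {m} {H} us (injective , adj) = record
  { distinct = λ {i} {j} _ i<j j≤m eq → <-irrefl
      (trans (sym (toℕ-fromℕ< (s≤s (≤-trans (<⇒≤ i<j) j≤m)))) (trans (cong toℕ (injective
        (trans (sym (at-lookup us (≤-trans (<⇒≤ i<j) j≤m))) (trans eq (at-lookup us j≤m)))))
        (toℕ-fromℕ< (s≤s j≤m)))) i<j
  ; edge = λ {i} _ i<m → subst₂ (Adj H) (sym (at-lookup us (<⇒≤ i<m))) (sym (at-lookup us i<m))
      (Equivalence.from (adj _ _) (inj₁ (trans (cong suc (toℕ-fromℕ< (s≤s (<⇒≤ i<m)))) (sym (toℕ-fromℕ< (s≤s i<m))))))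
  ; chordless = λ {i} {j} _ 1+i<j j≤m ij → let i≤m = ≤-trans (<⇒≤ (<-trans ≤-refl 1+i<j)) j≤m in
      no-chord 1+i<j (toℕ-fromℕ< (s≤s i≤m)) (toℕ-fromℕ< (s≤s j≤m))
        (Equivalence.to (adj _ _) (subst₂ (Adj H) (at-lookup us i≤m) (at-lookup us j≤m) ij))
  }
  where
  no-chord : ∀ {i j} {i′ j′ : Fin (suc m)} → suc i < j → toℕ i′ ≡ i → toℕ j′ ≡ j → ¬ PathAdj i′ j′
  no-chord 1+i<j refl refl (inj₁ e) = <-irrefl e 1+i<j
  no-chord 1+i<j refl refl (inj₂ e) = <-asym (<-trans ≤-refl 1+i<j) (≤-reflexive e)

isPath? : ∀ {v m} (G : Graph v) (us : Vec (Fin v) (suc m)) → Dec (IsPath G us)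
isPath? G us = injective? ×-dec all? λ i → all? λ j →
  Dec.map′ (λ (f , g) → mk⇔ f g) (λ e → Equivalence.to e , Equivalence.from e)
    ((adj? i j →-dec pathAdj? i j) ×-dec (pathAdj? i j →-dec adj? i j))
  where
  injective? : Dec (Injective _≡_ _≡_ (lookup us))
  injective? = Dec.map′ (λ f {i} {j} → f i j) (λ f i j → f)
    (all? λ i → all? λ j → (lookup us i ≟ᶠ lookup us j) →-dec (i ≟ᶠ j))
  adj? = λ i j → Graph.adj? G (lookup us i) (lookup us j)
  pathAdj? : ∀ i j → Dec (PathAdj i j)
  pathAdj? i j = (suc (toℕ i) ≟ toℕ j) ⊎-dec (suc (toℕ j) ≟ toℕ i)

-- Attachment orders for connected subsets

module _ {v : ℕ} (H : Graph v) where

  open import Data.List.Membership.DecPropositional (_≟ᶠ_ {v}) using () renaming (_∈?_ to _∈ˡ?_)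

  record Spanning (X : Subset v) : Set where
    field
      list     : List (Fin v)
      tree     : Tree H list
      sound    : ∀ {x} → x ∈ˡ list → x ∈ X
      complete : ∀ {x} → x ∈ X → x ∈ˡ list

  Closed : Subset v → List (Fin v) → Set
  Closed X L = ∀ {a b} → a ∈ˡ L → b ∈ X → Adj H a b → b ∈ˡ L

  closed⇒complete : ∀ {X L a w} → Closed X L → a ∈ˡ L →
    Star (λ a b → a ∈ X × b ∈ X × Adj H a b) a w → w ∈ˡ L
  closed⇒complete cl a∈ ε                    = a∈
  closed⇒complete cl a∈ ((_ , b∈ , a~b) ◅ w) = closed⇒complete cl (cl a∈ b∈ a~b) w

  -- Greedy exploration: `R` holds all candidates outside the current tree, and n bounds its length
  -- so that the recursion terminates. When no candidate can be attached, the list is closed under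
  -- neighbours in X.
  grow : ∀ {X L} n R → length R < n → Tree H L → (∀ {x} → x ∈ˡ L → x ∈ X) → (∀ {x} → x ∈ X → x ∈ˡ L ⊎ x ∈ˡ R) →
    ∃ λ L′ → Tree H L′ × (∀ {x} → x ∈ˡ L′ → x ∈ X) × Closed X L′
  grow {X} {L} (suc n) R R<n T sound cover
    with any? (λ b → (b ∈? X) ×-dec (¬? (b ∈ˡ? L) ×-dec any? (λ a → Graph.adj? H b a) L)) R
  ... | no none = L , T , sound , closed
    where
    closed : Closed X L
    closed {a} {b} a∈ b∈X a~b with b ∈ˡ? L
    ... | yes b∈ = b∈
    ... | no b∉ with cover b∈X
    ...   | inj₁ b∈ = b∈
    ...   | inj₂ b∈R = contradiction (lose b∈R (b∈X , b∉ , lose a∈ (Graph.symm H a~b))) none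
  ... | yes some with b , b∈R , b∈X , b∉L , nb ← find some with a , a∈ , b~a ← find nb =
    grow n (filter ≢b? R) (<-≤-trans (filter-notAll ≢b? R (lose b∈R (λ b≢b → b≢b refl))) (s≤s⁻¹ R<n))
      (attach b∉L a∈ b~a T) (λ { (here refl) → b∈X ; (there x∈) → sound x∈ }) cover′
    where
    ≢b? = λ x → ¬? (x ≟ᶠ b)
    cover′ : ∀ {x} → x ∈ X → x ∈ˡ b ∷ L ⊎ x ∈ˡ filter ≢b? R
    cover′ {x} x∈X with cover x∈X | x ≟ᶠ b
    ... | inj₁ x∈L | _       = inj₁ (there x∈L)
    ... | inj₂ _   | yes x≡b = inj₁ (here x≡b)
    ... | inj₂ x∈R | no x≢b  = inj₂ (∈-filter⁺ ≢b? x∈R x≢b)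

  spanning : ∀ {X} → Nonempty X → Connected H X → Spanning X
  spanning {X} (x₀ , x₀∈) conn
    with L , T , sound , closed ← grow {X} (suc (length (allFin v))) (allFin v) ≤-refl (root x₀)
           (λ { (here refl) → x₀∈ }) (λ _ → inj₂ (∈-allFin _))
    with z , z∈ ← tree-nonempty H T = record
    { list = L ; tree = T ; sound = sound
    ; complete = λ x∈ → closed⇒complete closed z∈ (conn (sound z∈) x∈) }

LeapPath : ∀ {v n} → Graph v → Subset v → Vec (Fin v) n → Set
LeapPath G X us = ∃₂ λ x x′ → x ∈ X × x′ ∈ X × ¬ Adj G x x′ × IsPath G (x ∷ (us ∷ʳ x′))

Outcomes : ∀ {v} → Graph v → Subset v → Subset v → ∀ k → Vec (Fin v) (suc (suc k)) → Set
Outcomes G X Y k P =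
  ( ( 4 ≤ suc k × LeapPath G X (tail P) )
  ⊎ ( 4 ≤ suc k × LeapPath G Y (init P) )
  ⊎ ( suc k ≡ 2 ×
      ∃₂ λ q r → AntipathBetween G X (head (tail P)) (last P) q × AntipathBetween G Y (head P) (head (tail P)) r ×
        ((Odd q × Even r) ⊎ (Even q × Odd r)) ) )
  × ( ¬ Balanced G (vertices P - head P) X ⊎ ¬ Balanced G (vertices P - last P) Y )

-- Bad segments and the inductive claim

module _ {v : ℕ} (G : Graph v) (berge : Berge G) where

  private
    V = Fin v
    Ḡ = complement G

  adj⇒¬co-adj : ∀ {u w} → Adj G u w → ¬ Adj Ḡ u w
  adj⇒¬co-adj u~w (_ , u≁w) = u≁w u~w

  ¬co-adj⇒adj : ∀ {u w} → u ≢ w → ¬ Adj Ḡ u w → Adj G u w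
  ¬co-adj⇒adj {u} {w} u≢w ¬co = decidable-stable (Graph.adj? G u w) (λ u≁w → ¬co (u≢w , u≁w))

  adj⇒≢ : ∀ {u w} → Adj G u w → u ≢ w
  adj⇒≢ u~w u≡w = Graph.irrefl G u≡w u~w

  Complete : List V → V → Set
  Complete T w = All (Adj G w) T

  complete? : ∀ T → U.Decidable (Complete T)
  complete? T w = All.all? (Graph.adj? G w) T

  antineighbour : ∀ {T w} → ¬ Complete T w → w ∉ˡ T → ∃ λ u → u ∈ˡ T × Adj Ḡ w u
  antineighbour {T} {w} ¬c w∉ with u , u∈ , w≁u ← find (¬All⇒Any¬ (Graph.adj? G w) T ¬c) =
    u , u∈ , (λ { refl → w∉ u∈ }) , w≁u

  between : ∀ {T a b} → Tree Ḡ T → ¬ Complete T a → a ∉ˡ T → ¬ Complete T b → b ∉ˡ T → Through Ḡ T a b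
  between T ¬ca a∉ ¬cb b∉ with u , u∈ , a~u ← antineighbour ¬ca a∉ | w , w∈ , b~w ← antineighbour ¬cb b∉ =
    tree-through Ḡ T u∈ a~u w∈ b~w

  -- For a path segment off T with i < j these adjacencies make x, p_i, ..., p_j, x′ an induced
  -- path. Its ends are distinct because x′ misses p_i while x sees it.
  record Leap (T : List V) (p : ℕ → V) (i j : ℕ) : Set where
    field
      {x x′}   : V
      x∈       : x ∈ˡ T
      x′∈      : x′ ∈ˡ T
      x≁x′     : ¬ Adj G x x′
      x~first  : Adj G x (p i)
      x≁rest   : ∀ {k} → i < k → k ≤ j → ¬ Adj G x (p k)
      x′~last  : Adj G x′ (p j)
      x′≁rest  : ∀ {k} → i ≤ k → k < j → ¬ Adj G x′ (p k)

  OddThrough : List V → V → V → Set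
  OddThrough T a b = Σ (Through Ḡ T a b) λ L → Odd (Through.len L)

  -- The segment p i, …, p j and the set T do not form a balanced pair.
  record Bad (T : List V) (p : ℕ → V) (i j : ℕ) : Set where
    constructor mkBad
    field
      i<j   : i < j
      odd   : parity i ≢ parity j
      shape : Leap T p i j ⊎ (j ≡ suc i × OddThrough T (p i) (p j))

  bad-mono : ∀ {S T p i j} → S ⊆ˡ T → Bad S p i j → Bad T p i j
  bad-mono S⊆T (mkBad i<j odd (inj₁ L)) = mkBad i<j odd (inj₁ record { Leap L ; x∈ = S⊆T (Leap.x∈ L) ; x′∈ = S⊆T (Leap.x′∈ L) })
  bad-mono S⊆T (mkBad i<j odd (inj₂ (e , Q , o))) = mkBad i<j odd (inj₂ (e , through-mono Ḡ S⊆T Q , o))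

  bad-reverse : ∀ {T p q i j N} → j ≤ N → (∀ {k} → k ≤ N → q (N ∸ k) ≡ p k) →
    Bad T p i j → Bad T q (N ∸ j) (N ∸ i)
  bad-reverse {T} {p} {q} {i} {j} {N} j≤N q≗p (mkBad i<j odd shape) =
    mkBad (∸-monoʳ-< i<j j≤N) (odd ∘ sym ∘ parity-reflect j≤N i≤N) (reversed shape)
    where
    i≤N : i ≤ N
    i≤N = ≤-trans (<⇒≤ i<j) j≤N
    q≡ : ∀ {k} → k ≤ N → q k ≡ p (N ∸ k)
    q≡ {k} k≤N = trans (cong q (sym (m∸[m∸n]≡n k≤N))) (q≗p (m∸n≤m N k))
    lo : ∀ {k} → k ≤ N ∸ i → i ≤ N ∸ k
    lo {k} k≤ = subst (_≤ N ∸ k) (m∸[m∸n]≡n i≤N) (∸-monoʳ-≤ N k≤)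
    lo< : ∀ {k} → k < N ∸ i → i < N ∸ k
    lo< {k} k< = subst (_< N ∸ k) (m∸[m∸n]≡n i≤N) (∸-monoʳ-< k< (m∸n≤m N i))
    hi : ∀ {k} → N ∸ j ≤ k → N ∸ k ≤ j
    hi {k} ≤k = subst (N ∸ k ≤_) (m∸[m∸n]≡n j≤N) (∸-monoʳ-≤ N ≤k)
    hi< : ∀ {k} → N ∸ j < k → k ≤ N → N ∸ k < j
    hi< {k} <k k≤N = subst (N ∸ k <_) (m∸[m∸n]≡n j≤N) (∸-monoʳ-< <k k≤N)
    up : ∀ {k} → k ≤ N ∸ i → k ≤ N
    up k≤ = ≤-trans k≤ (m∸n≤m N i)
    reversed : Leap T p i j ⊎ (j ≡ suc i × OddThrough T (p i) (p j)) →
      Leap T q (N ∸ j) (N ∸ i) ⊎ (N ∸ i ≡ suc (N ∸ j) × OddThrough T (q (N ∸ j)) (q (N ∸ i)))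
    reversed (inj₁ L) = inj₁ record
      { x∈ = x′∈ ; x′∈ = x∈ ; x≁x′ = x≁x′ ∘ Graph.symm G
      ; x~first = subst (Adj G x′) (sym (q≗p j≤N)) x′~last
      ; x≁rest  = λ <k k≤ adj → x′≁rest (lo k≤) (hi< <k (up k≤)) (subst (Adj G x′) (q≡ (up k≤)) adj)
      ; x′~last = subst (Adj G x) (sym (q≗p i≤N)) x~first
      ; x′≁rest = λ ≤k k< adj → x≁rest (lo< k<) (hi ≤k) (subst (Adj G x) (q≡ (up (<⇒≤ k<))) adj)
      }
      where open Leap L
    reversed (inj₂ (refl , Q , o)) = inj₂ (m∸n≡1+[m∸1+n] j≤N ,
      subst₂ (OddThrough T) (sym (q≗p j≤N)) (sym (q≗p i≤N)) (through-sym Ḡ Q , o))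

  -- A leap together with z forms the hole z, x, p_i, ..., p_j, x′ with j - i + 4 vertices, an odd
  -- number. An odd antipath of length l together with z forms an antihole with l + 2 vertices.
  bad-closed : ∀ {T p i j z} → Path G p i j → (∀ {k} → i ≤ k → k ≤ j → p k ∉ˡ T) → Complete T z →
    (∀ {k} → i ≤ k → k ≤ j → Adj Ḡ z (p k)) → ¬ Bad T p i j
  bad-closed {T} {p} {i} {j} {z} P off z-complete z-apart (mkBad i<j odd (inj₁ L)) =
    no-odd-cycle G (proj₁ berge) P″ (s≤s (s≤s z≤n)) (odd-∸ i≤j odd)
      (Graph.symm G (All.lookup z-complete x′∈)) (subst (Adj G x′ ∘ p) (sym i+m≡j) x′~last) inner
    where
    open Leap L
    i≤j = <⇒≤ i<j
    m = j ∸ i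
    i+m≡j : i + m ≡ j
    i+m≡j = m+[n∸m]≡n i≤j
    up : ∀ {k} → k ≤ m → i + k ≤ j
    up {k} k≤m = subst (i + k ≤_) i+m≡j (+-monoʳ-≤ i k≤m)
    q = λ k → p (i + k)
    P′ : Path G (x ◂ q) 0 (suc m)
    P′ = path-cons (path-shift m (≤-reflexive i+m≡j) P)
      (subst (Adj G x ∘ p) (sym (+-identityʳ i)) x~first)
      (λ {k} 0<k k≤m → x≁rest (m<m+n i 0<k) (up k≤m))
      (λ {k} k≤m x≡ → off (m≤m+n i k) (up k≤m) (subst (_∈ˡ T) x≡ x∈))
    z∉ : ∀ {k} → k ≤ suc m → z ≢ (x ◂ q) k
    z∉ {zero}  _  z≡ = adj⇒≢ (All.lookup z-complete x∈) z≡
    z∉ {suc k} k≤ z≡ = proj₁ (z-apart (m≤m+n i k) (up (s≤s⁻¹ k≤))) z≡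
    z≁ : ∀ {k} → 0 < k → k ≤ suc m → ¬ Adj G z ((x ◂ q) k)
    z≁ {suc k} _ k≤ = proj₂ (z-apart (m≤m+n i k) (up (s≤s⁻¹ k≤)))
    P″ : Path G (z ◂ x ◂ q) 0 (suc (suc m))
    P″ = path-cons P′ (All.lookup z-complete x∈) z≁ z∉
    inner : ∀ {k} → 0 < k → k < suc (suc m) → ¬ Adj G x′ ((z ◂ x ◂ q) k)
    inner {suc zero}    _ _  = x≁x′ ∘ Graph.symm G
    inner {suc (suc k)} _ k< = x′≁rest (m≤m+n i k) (subst (i + k <_) i+m≡j (+-monoʳ-< i (s≤s⁻¹ (s≤s⁻¹ k<))))
  bad-closed P off z-complete z-apart (mkBad i<j odd (inj₂ (refl , Q , o))) =
    no-odd-through Ḡ (proj₂ berge) Q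
      (through-long Ḡ (distinct P ≤-refl ≤-refl ≤-refl) (adj⇒¬co-adj (edge P ≤-refl ≤-refl)) Q) o
      (z-apart ≤-refl (<⇒≤ i<j)) (z-apart (<⇒≤ i<j) ≤-refl) (λ u∈ → adj⇒¬co-adj (All.lookup z-complete u∈))

  ¬bad-singleton : ∀ {x p i j} → Path G p i j → ¬ Bad (x ∷ []) p i j
  ¬bad-singleton P (mkBad i<j odd (inj₁ record { x∈ = here refl ; x′∈ = here refl ; x~first = x~ ; x′≁rest = x≁ })) =
    x≁ ≤-refl i<j x~
  ¬bad-singleton P (mkBad i<j odd (inj₂ (refl , Q , o))) =
    no-odd-through-singleton Ḡ (distinct P ≤-refl ≤-refl ≤-refl) (adj⇒¬co-adj (edge P ≤-refl ≤-refl)) Q o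

  record Setting (X Y : List V) (p : ℕ → V) (s t : ℕ) : Set where
    field
      X-tree : Tree Ḡ X
      Y-tree : Tree Ḡ Y
      X~Y    : ∀ {x y} → x ∈ˡ X → y ∈ˡ Y → Adj G x y
      path   : Path G p s t
      s<t    : s < t
      even   : parity s ≡ parity t
      off-X  : ∀ {k} → s ≤ k → k ≤ t → p k ∉ˡ X
      off-Y  : ∀ {k} → s ≤ k → k ≤ t → p k ∉ˡ Y
      startX : Complete X (p s)
      onlyX  : ∀ {k} → s < k → k ≤ t → ¬ Complete X (p k)
      endY   : Complete Y (p t)
      onlyY  : ∀ {k} → s ≤ k → k < t → ¬ Complete Y (p k)

  -- The two excluded segments, P without its first vertex for X and P without its last for Y, are
  -- those of the unbalanced pairs in the theorem.
  Claim : List V → List V → Set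
  Claim X Y = ∀ {p s t} → Setting X Y p s t → ¬ Bad X p (suc s) t → ¬ Bad Y p s (pred t) → ⊥

  ClaimBelow : ℕ → Set
  ClaimBelow n = ∀ {X Y} → length X + length Y < n → Claim X Y

  setting-reverse : ∀ {X Y p s t} → Setting X Y p s t → Setting Y X (λ k → p (s + t ∸ k)) s t
  setting-reverse {X} {Y} {p} {s} {t} S = record
    { X-tree = Y-tree ; Y-tree = X-tree
    ; X~Y    = λ y∈ x∈ → Graph.symm G (X~Y x∈ y∈)
    ; path   = path-reflect (s + t) s t (m≤n+m t s) (∸-lower s t ≤-refl) (∸-upper s t ≤-refl) path
    ; s<t    = s<t ; even = even
    ; off-X  = λ s≤k k≤t → off-Y (∸-lower s t k≤t) (∸-upper s t s≤k)
    ; off-Y  = λ s≤k k≤t → off-X (∸-lower s t k≤t) (∸-upper s t s≤k)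
    ; startX = subst (Complete Y ∘ p) (sym (m+n∸m≡n s t)) endY
    ; onlyX  = λ s<k k≤t → onlyY (∸-lower s t k≤t) (∸-upper-< s t s<k k≤t)
    ; endY   = subst (Complete X ∘ p) (sym (m+n∸n≡m s t)) startX
    ; onlyY  = λ s≤k k<t → onlyX (∸-lower-< s t k<t) (∸-upper s t s≤k)
    }
    where open Setting S

  ¬bad-last : ∀ {Y p s t} → s < t → ¬ Bad Y p s (pred t) → ¬ Bad Y (λ k → p (s + t ∸ k)) (suc s) t
  ¬bad-last {Y} {p} {s} {t} s<t ¬b b = ¬b (subst₂ (Bad Y p) (m+n∸n≡m s t)
    (trans (sym (pred[m∸n]≡m∸[1+n] (s + t) s)) (cong pred (m+n∸m≡n s t)))
    (bad-reverse (m≤n+m t s) (λ _ → refl) b))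

  ¬bad-first : ∀ {X p s t} → s < t → ¬ Bad X p (suc s) t → ¬ Bad X (λ k → p (s + t ∸ k)) s (pred t)
  ¬bad-first {X} {p} {s} {suc t} s<t ¬b b = ¬b (subst₂ (Bad X p)
    (trans (cong (_∸ t) (+-suc s t)) (m+n∸n≡m (suc s) t)) (m+n∸m≡n s (suc t))
    (bad-reverse (≤-trans (n≤1+n t) (m≤n+m (suc t) s)) (λ _ → refl) b))

  -- An x–p_i–…–p_j–x′ leap starting at i = s + 1 < t has Y-complete ends, so the claim for
  -- ({x}, Y) yields a bad configuration of Y on the same segment, which p_t closes up.
  ¬badX : ∀ {X Y p s t} → ClaimBelow (length X + length Y) → Setting X Y p s t → ¬ Bad X p (suc s) t →
    ∀ {i j} → s < i → j ≤ t → ¬ Bad X p i j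
  ¬badX {X} {Y} {p} {s} {t} ih S ¬bad {i} {j} s<i j≤t b with m≤n⇒m<n∨m≡n s<i | m≤n⇒m<n∨m≡n j≤t
  ... | inj₂ refl | inj₂ refl = ¬bad b
  ... | inj₁ 1+s<i | _ = bad-closed (path-sub (<⇒≤ s<i) j≤t path)
        (λ i≤k k≤j → off-X (≤-trans (<⇒≤ s<i) i≤k) (≤-trans k≤j j≤t)) startX
        (λ i≤k k≤j → distinct path ≤-refl (≤-trans s<i i≤k) (≤-trans k≤j j≤t) ,
                     chordless path ≤-refl (≤-trans 1+s<i i≤k) (≤-trans k≤j j≤t)) b
    where open Setting S
  ... | inj₂ refl | inj₁ j<t = go X-tree b
    where
    open Setting S
    i<j = Bad.i<j b
    i≤j = <⇒≤ i<j
    -- The segment from s + 1 to j has odd length, so j has the parity of s and of t. Hence j is not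
    -- t - 1, and p_t misses the whole segment.
    1+j<t : suc j < t
    1+j<t with m≤n⇒m<n∨m≡n j<t
    ... | inj₁ 1+j<t = 1+j<t
    ... | inj₂ refl = contradiction (trans (sym (odd-step i j (Bad.odd b))) even) (n≢1+n-parity j)
    P : Path G p i j
    P = path-sub (n≤1+n s) j≤t path
    up : ∀ {k} → i ≤ k → s ≤ k
    up i≤k = ≤-trans (n≤1+n s) i≤k
    t-apart : ∀ {k} → i ≤ k → k ≤ j → Adj Ḡ (p t) (p k)
    t-apart i≤k k≤j = ≢-sym (distinct path (up i≤k) (≤-<-trans k≤j j<t) ≤-refl) ,
                      chordless′ path (up i≤k) (≤-<-trans (s≤s k≤j) 1+j<t) ≤-refl
    closed : ¬ Bad Y p i j
    closed = bad-closed P (λ i≤k k≤j → off-Y (up i≤k) (≤-trans k≤j j≤t)) endY t-apart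
    go : Tree Ḡ X → Bad X p i j → ⊥
    go (root x) b = ¬bad-singleton P b
    go (attach {xs = xs} _ w∈ _ _) (mkBad _ odd (inj₁ L)) = ih small S′ ¬Y (¬bad-singleton P′)
      where
      open Leap L
      m = j ∸ i
      small : length Y + length (x ∷ []) < length X + length Y
      small = subst (_< length X + length Y) (+-comm 1 (length Y)) (+-monoˡ-< (length Y) (1<1+length w∈))
      -- The path x′, p_j, ..., p_i has even length; x′ is its only Y-complete vertex and p_i is its
      -- only neighbour of x. So Y takes the place of X here, and {x} that of Y.
      q = x′ ◂ (λ k → p (j ∸ k))
      j∸m≡i : j ∸ m ≡ i
      j∸m≡i = m∸[m∸n]≡n i≤j
      lo : ∀ {k} → k ≤ m → i ≤ j ∸ k
      lo {k} k≤m = subst (_≤ j ∸ k) j∸m≡i (∸-monoʳ-≤ j k≤m)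
      m≤j : m ≤ j
      m≤j = m∸n≤m j i
      disjoint : ∀ {z} → z ∈ˡ X → z ∉ˡ Y
      disjoint z∈X z∈Y = Graph.irrefl G refl (X~Y z∈X z∈Y)
      Pq : Path G q 0 (suc m)
      Pq = path-cons (path-reflect j 0 m m≤j (≤-reflexive (sym j∸m≡i)) ≤-refl P)
        x′~last (λ {k} 0<k k≤m → x′≁rest (lo k≤m) (∸-monoʳ-< 0<k (≤-trans k≤m m≤j)))
        (λ {k} k≤m x′≡ → off-X (up (lo k≤m)) (≤-trans (m∸n≤m j k) j≤t) (subst (_∈ˡ X) x′≡ x′∈))
      P′ : Path G q 0 m
      P′ = path-sub z≤n (n≤1+n m) Pq
      offY′ : ∀ {k} → 0 ≤ k → k ≤ suc m → q k ∉ˡ Y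
      offY′ {zero}  _ _  = disjoint x′∈
      offY′ {suc k} _ k≤ = off-Y (up (lo (s≤s⁻¹ k≤))) (≤-trans (m∸n≤m j k) j≤t)
      offx : ∀ {k} → 0 ≤ k → k ≤ suc m → q k ∉ˡ x ∷ []
      offx {zero}  _ _  (here refl) = x′≁rest ≤-refl i<j x~first
      offx {suc k} _ k≤ (here e)    = off-X (up (lo (s≤s⁻¹ k≤))) (≤-trans (m∸n≤m j k) j≤t) (subst (_∈ˡ X) (sym e) x∈)
      onlyY′ : ∀ {k} → 0 < k → k ≤ suc m → ¬ Complete Y (q k)
      onlyY′ {suc k} _ k≤ = onlyY (up (lo (s≤s⁻¹ k≤))) (≤-<-trans (m∸n≤m j k) j<t)
      onlyx : ∀ {k} → 0 ≤ k → k < suc m → ¬ Complete (x ∷ []) (q k)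
      onlyx {zero}  _ _  (x′~x ∷ []) = x≁x′ (Graph.symm G x′~x)
      onlyx {suc k} _ k< (~x ∷ [])   = x≁rest (subst (_< j ∸ k) j∸m≡i (∸-monoʳ-< (s≤s⁻¹ k<) m≤j)) (m∸n≤m j k) (Graph.symm G ~x)
      S′ : Setting Y (x ∷ []) q 0 (suc m)
      S′ = record
        { X-tree = Y-tree ; Y-tree = root x
        ; X~Y    = λ { y∈ (here refl) → Graph.symm G (X~Y x∈ y∈) }
        ; path   = Pq
        ; s<t    = z<s
        ; even   = sym (even-suc m (odd-∸ i≤j odd))
        ; off-X  = offY′ ; off-Y = offx
        ; startX = All.tabulate (X~Y x′∈)
        ; onlyX  = onlyY′
        ; endY   = Graph.symm G (subst (Adj G x ∘ p) (sym j∸m≡i) x~first) ∷ []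
        ; onlyY  = onlyx
        }
      apart′ : ∀ {k} → 1 ≤ k → k ≤ suc m → Adj Ḡ (p t) (q k)
      apart′ {suc k} _ k≤ = t-apart (lo (s≤s⁻¹ k≤)) (m∸n≤m j k)
      ¬Y : ¬ Bad Y q 1 (suc m)
      ¬Y = bad-closed (path-sub z≤n ≤-refl Pq) (λ _ → offY′ z≤n) endY apart′
    -- As X is complete to Y, an antipath between p_i and p_j through Y closes `Q` to an antihole.
    -- It is therefore odd too and makes the segment bad for Y, which p_t rules out.
    go _ (mkBad _ odd (inj₂ (refl , Q , o))) =
      closed (mkBad i<j odd (inj₂ (refl , R , trans (sym same) o)))
      where
      R : Through Ḡ Y (p i) (p j)
      R = between Y-tree (onlyY (n≤1+n s) (≤-trans i<j j≤t)) (off-Y (n≤1+n s) (≤-trans i≤j j≤t))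
                         (onlyY (up i≤j) j<t) (off-Y (up i≤j) j≤t)
      module Q = Through Q
      module R = Through R
      long : ∀ {T} (L : Through Ḡ T (p i) (p j)) → 2 ≤ Through.len L
      long = through-long Ḡ (distinct P ≤-refl ≤-refl ≤-refl) (adj⇒¬co-adj (edge P ≤-refl ≤-refl))
      module R′ = Through (through-sym Ḡ R)
      same : parity Q.len ≡ parity R.len
      same = two-paths (proj₂ berge) Q.path R′.path (long Q) (long R)
        (trans Q.start (sym R′.finish)) (trans Q.finish (sym R′.start))
        (λ 0<i i< 0<j j< → adj⇒¬co-adj (X~Y (Q.inner 0<i i<) (R′.inner 0<j j<)))
        (λ 0<i i< 0<j j< eq → adj⇒≢ (X~Y (Q.inner 0<i i<) (R′.inner 0<j j<)) eq)

  ¬badY : ∀ {X Y p s t} → ClaimBelow (length X + length Y) → Setting X Y p s t → ¬ Bad Y p s (pred t) →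
    ∀ {i j} → s ≤ i → j < t → ¬ Bad Y p i j
  ¬badY {X} {Y} {p} {s} {t} ih S ¬bad {i} {j} s≤i j<t b =
    ¬badX (subst ClaimBelow (+-comm (length X) (length Y)) ih) (setting-reverse S) (¬bad-last s<t ¬bad)
      (∸-lower-< s t j<t) (∸-upper s t s≤i)
      (bad-reverse (≤-trans (<⇒≤ j<t) (m≤n+m t s)) (λ k≤ → cong p (m∸[m∸n]≡n k≤)) b)
    where open Setting S

  -- Splitting X into two smaller anticonnected sets

  module Step {X Y : List V} {p : ℕ → V} {s t : ℕ}
    (ih : ClaimBelow (length X + length Y)) (S : Setting X Y p s t)
    (¬bX : ¬ Bad X p (suc s) t) (¬bY : ¬ Bad Y p s (pred t)) (t≢2+s : t ≢ suc (suc s)) where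

    open Setting S

    record Part (U : List V) : Set where
      field
        tree  : Tree Ḡ U
        sub   : U ⊆ˡ X
        short : length U < length X

    s≤t : s ≤ t
    s≤t = <⇒≤ s<t

    Y-nonempty : 1 ≤ length Y
    Y-nonempty with Y-tree
    ... | root _         = ≤-refl
    ... | attach _ _ _ _ = s≤s z≤n

    no-bad : ∀ {U} → U ⊆ˡ X → ∀ {i j} → s < i → j ≤ t → ¬ Bad U p i j
    no-bad U⊆X s<i j≤t b = ¬badX ih S ¬bX s<i j≤t (bad-mono U⊆X b)

    part-complete : ∀ {U} → Part U → Complete U (p s)
    part-complete PU = anti-mono (Part.sub PU) startX

    -- A longer odd gap would be an instance of the claim for {p i} and U on p (i + 1), …, p j.
    complete-spaced : ∀ {U} → Part U → Spaced (Complete U ∘ p) s t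
    complete-spaced {U} PU {i} {j} s≤i i<j j≤t ci cj gap with parity i ℙₚ.≟ parity j | m≤n⇒m<n∨m≡n i<j
    ... | yes i≡j | _ = inj₂ i≡j
    ... | no _    | inj₂ 1+i≡j = inj₁ (sym 1+i≡j)
    ... | no i≢j  | inj₁ 1+i<j = ⊥-elim (ih small S′
            (¬bad-singleton (path-sub (m≤n⇒m≤1+n (m≤n⇒m≤1+n s≤i)) j≤t path))
            (no-bad sub (s≤s s≤i) (≤-trans (pred[n]≤n {j}) j≤t)))
      where
      open Part PU
      -- From |U| < |X| and |Y| ≥ 1 comes 1 + |U| < |X| + |Y|.
      small : length (p i ∷ []) + length U < length X + length Y
      small = ≤-trans (subst (_≤ length X + 1) (+-comm (suc (length U)) 1) (+-monoˡ-≤ 1 short))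
                      (+-monoʳ-≤ (length X) Y-nonempty)
      S′ : Setting (p i ∷ []) U p (suc i) j
      S′ = record
        { X-tree = root (p i) ; Y-tree = tree
        ; X~Y    = λ { (here refl) u∈ → All.lookup ci u∈ }
        ; path   = path-sub (m≤n⇒m≤1+n s≤i) j≤t path
        ; s<t    = 1+i<j
        ; even   = odd-step i j i≢j
        ; off-X  = λ { i<k k≤j (here e) → distinct path s≤i i<k (≤-trans k≤j j≤t) (sym e) }
        ; off-Y  = λ i<k k≤j → off-X (≤-trans s≤i (<⇒≤ i<k)) (≤-trans k≤j j≤t) ∘ sub
        ; startX = Graph.symm G (edge path s≤i (≤-trans i<j j≤t)) ∷ []
        ; onlyX  = λ { 1+i<k k≤j (~ ∷ []) → chordless′ path s≤i 1+i<k (≤-trans k≤j j≤t) ~ }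
        ; endY   = cj
        ; onlyY  = λ i<k k<j → gap i<k k<j
        }

    -- If α were before t and at even distance from it, then p_α, ..., p_t with U and Y would be a
    -- smaller instance: p_α is the only U-complete vertex from α on, because α is the last such
    -- position.
    last-complete : ∀ {U α} → Part U → Last (Complete U ∘ p) s t α → α ≡ t ⊎ parity α ≢ parity t
    last-complete {U} {α} PU (mkLast s≤α α≤t cα none) with m≤n⇒m<n∨m≡n α≤t | parity α ℙₚ.≟ parity t
    ... | inj₂ α≡t | _ = inj₁ α≡t
    ... | _        | no α≢t = inj₂ α≢t
    ... | inj₁ α<t | yes α≡t = ⊥-elim (ih (+-monoˡ-< (length Y) short) S′
            (no-bad sub (s≤s s≤α) ≤-refl)
            (¬badY ih S ¬bY s≤α (pred-< s<t)))
      where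
      open Part PU
      S′ : Setting U Y p α t
      S′ = record
        { X-tree = tree ; Y-tree = Y-tree
        ; X~Y    = λ u∈ y∈ → X~Y (sub u∈) y∈
        ; path   = path-sub s≤α ≤-refl path
        ; s<t    = α<t
        ; even   = α≡t
        ; off-X  = λ α≤k k≤t → off-X (≤-trans s≤α α≤k) k≤t ∘ sub
        ; off-Y  = λ α≤k k≤t → off-Y (≤-trans s≤α α≤k) k≤t
        ; startX = cα
        ; onlyX  = none
        ; endY   = endY
        ; onlyY  = λ α≤k k<t → onlyY (≤-trans s≤α α≤k) k<t
        }

    Covering : List V → List V → Set
    Covering U W = ∀ {w} → Complete U w → Complete W w → Complete X w

    not-both : ∀ {U W} → Covering U W → ∀ {k} → s < k → k ≤ t → Complete U (p k) → ¬ Complete W (p k)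
    not-both cover s<k k≤t cu cw = onlyX s<k k≤t (cover cu cw)

    -- Being at even distance from t, α must equal t. Then β is t as well, and p_t would be
    -- X-complete.
    smaller-last : ∀ {U W α β} → Part U → Covering U W → Last (Complete U ∘ p) s t α → Last (Complete W ∘ p) s t β →
      α ≤ β → parity α ≡ parity s → ⊥
    smaller-last {U} {W} PU cover lα lβ α≤β α≡s with last-complete PU lα
    ... | inj₂ α≢t = α≢t (trans α≡s even)
    ... | inj₁ refl = not-both cover s<t ≤-refl (Last.holds lα)
            (subst (Complete W ∘ p) (≤-antisym (Last.upper lβ) α≤β) (Last.holds lβ))

    even-switch⇒⊥ : ∀ {U W} → Part U → Part W → Covering U W →
      EvenSwitch (Complete U ∘ p) (Complete W ∘ p) s t → EvenSwitch (Complete W ∘ p) (Complete U ∘ p) s t → ⊥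
    even-switch⇒⊥ {U} {W} PU PW cover sw sw′
      with α , β , lα , lβ , α≤β⇒ , β≤α⇒ ← scan (complete? U ∘ p) (complete? W ∘ p) s≤t
             (part-complete PU) (part-complete PW) (not-both cover)
             (complete-spaced PU) (complete-spaced PW) sw sw′
      with ≤-total α β
    ... | inj₁ α≤β = smaller-last PU cover lα lβ α≤β (α≤β⇒ α≤β)
    ... | inj₂ β≤α = smaller-last PW (λ cw cu → cover cu cw) lβ lα β≤α (β≤α⇒ β≤α)

    Touching : (A B : ℕ → Set) → Set
    Touching A B = ∀ {i j} → s < i → i ≤ t → s < j → j ≤ t → A i → B j → Adj G (p i) (p j)

    -- Adjacency forces β = α + 1, and any U-complete vertex strictly between s and α would see p_β
    -- along a chord. Since α < t, it is at odd distance from t, so β is at even distance and must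
    -- be t itself. Spacing between s and α now leaves only α = s + 1, that is t = s + 2, the case
    -- treated separately.
    touching-step : ∀ {U W α β} → Part U → Part W → Touching (Complete U ∘ p) (Complete W ∘ p) →
      Last (Complete U ∘ p) s t α → Last (Complete W ∘ p) s t β → s < α → α < β → ⊥
    touching-step {U} {W} {α} {β} PU PW touch lα lβ s<α α<β = contra (last-complete PU lα) (last-complete PW lβ)
      where
      s<β = <-trans s<α α<β
      β≤t = Last.upper lβ
      1+α≡β : suc α ≡ β
      1+α≡β = adjacent⇒consecutive path (<⇒≤ s<α) α<β β≤t
        (touch s<α (Last.upper lα) s<β β≤t (Last.holds lα) (Last.holds lβ))
      gap : Gap (Complete U ∘ p) s α
      gap s<k k<α c = chordless path (<⇒≤ s<k) (<-≤-trans (s≤s k<α) α<β) β≤t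
        (touch s<k (≤-trans (<⇒≤ k<α) (Last.upper lα)) s<β β≤t c (Last.holds lβ))
      contra : α ≡ t ⊎ parity α ≢ parity t → β ≡ t ⊎ parity β ≢ parity t → ⊥
      contra (inj₁ refl) _ = <⇒≱ α<β β≤t
      contra (inj₂ α≢t) (inj₂ β≢t) = β≢t (trans (cong parity (sym 1+α≡β)) (odd-step α t α≢t))
      contra (inj₂ α≢t) (inj₁ β≡t) with complete-spaced PU ≤-refl s<α (Last.upper lα) (part-complete PU) (Last.holds lα) gap
      ... | inj₁ α≡1+s = t≢2+s (trans (sym β≡t) (trans (sym 1+α≡β) (cong suc α≡1+s)))
      ... | inj₂ s≡α = α≢t (trans (sym s≡α) even)

    last-after : ∀ {U α} → Part U → Last (Complete U ∘ p) s t α → s < α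
    last-after PU lα with m≤n⇒m<n∨m≡n (Last.lower lα)
    ... | inj₁ s<α = s<α
    ... | inj₂ refl with last-complete PU lα
    ...   | inj₁ refl = contradiction s<t (<-irrefl refl)
    ...   | inj₂ s≢t = contradiction even s≢t

    touching⇒⊥ : ∀ {U W} → Part U → Part W → Covering U W → Touching (Complete U ∘ p) (Complete W ∘ p) → ⊥
    touching⇒⊥ {U} {W} PU PW cover touch
      with α , lα ← findLast (complete? U ∘ p) s≤t (part-complete PU)
         | β , lβ ← findLast (complete? W ∘ p) s≤t (part-complete PW)
      with <-cmp α β
    ... | tri< α<β _ _ = touching-step PU PW touch lα lβ (last-after PU lα) α<β
    ... | tri≈ _ refl _ = not-both cover (last-after PU lα) (Last.upper lα) (Last.holds lα) (Last.holds lβ)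
    ... | tri> _ _ β<α = touching-step PW PU (λ s<i i≤t s<j j≤t ci cj → Graph.symm G (touch s<j j≤t s<i i≤t cj ci))
            lβ lα (last-after PW lβ) β<α

    module PairCase (D : Pair Ḡ X) where
      open Pair D public

      Rx = Without.others minusX
      Ry = Without.others minusY

      part-x : Part Rx
      part-x = record { tree = Without.tree minusX ; sub = Without.within minusX ; short = Without.shorter minusX }

      W⊆X : W ⊆ˡ X
      W⊆X = Without.within minusX ∘ W⊆x

      part-W : Part W
      part-W = record { tree = W-tree ; sub = W⊆X ; short = W-short }

      y∈Rx : y ∈ˡ Rx
      y∈Rx = Without.remaining minusX y∈ (≢-sym x≢y)

      x∈Ry : x ∈ˡ Ry
      x∈Ry = Without.remaining minusY x∈ x≢y

      cover : Covering Rx Ry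
      cover {w} cx cy = All.tabulate λ z∈ → adj (Without.covers minusX z∈)
        where
        adj : ∀ {z} → z ∈ˡ x ∷ Rx → Adj G w z
        adj (here refl) = All.lookup cy x∈Ry
        adj (there z∈)  = All.lookup cx z∈

      co-x : ∀ {k} → s < k → k ≤ t → Complete Rx (p k) → Adj Ḡ (p k) x
      co-x {k} s<k k≤t ck = (λ { refl → off-X (<⇒≤ s<k) k≤t x∈ }) , λ ~x → onlyX s<k k≤t
        (All.tabulate λ z∈ → adj ~x (Without.covers minusX z∈))
        where
        adj : ∀ {z} → Adj G (p k) x → z ∈ˡ x ∷ Rx → Adj G (p k) z
        adj ~x (here refl) = ~x
        adj ~x (there z∈)  = All.lookup ck z∈

      off-W : ∀ {k} → s ≤ k → k ≤ t → p k ∉ˡ W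
      off-W s≤k k≤t = off-X s≤k k≤t ∘ W⊆X

      -- The vertex p_k misses x, since otherwise it would be X-complete, and sees y and all of `W`.
      -- So it can precede x on the antipath.
      extend : ∀ {k} → s < k → k ≤ t → Complete Rx (p k) → (Q : Through Ḡ W x y) →
        Σ (Through Ḡ (x ∷ W) (p k) y) λ Q′ → Through.len Q′ ≡ suc (Through.len Q)
      extend s<k k≤t ck Q = through-cons Ḡ (co-x s<k k≤t ck) (proj₁ (co-x s<k k≤t ck))
        (adj⇒¬co-adj (All.lookup ck y∈Rx)) (adj⇒≢ (All.lookup ck y∈Rx))
        (λ z∈ → adj⇒¬co-adj (All.lookup ck (W⊆x z∈))) (off-W (<⇒≤ s<k) k≤t) Q

      long : (Q : Through Ḡ W x y) → 2 ≤ Through.len Q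
      long = through-long Ḡ x≢y x≁y

    open PairCase using (Rx)

    Ry : Pair Ḡ X → List V
    Ry D = Rx (pair-swap Ḡ D)

    -- A nonadjacent pair would close the even antipath to an odd antihole.
    touching : (D : Pair Ḡ X) (Q : Through Ḡ (Pair.W D) (Pair.x D) (Pair.y D)) → Even (Through.len Q) →
      Touching (Complete (Rx D) ∘ p) (Complete (Ry D) ∘ p)
    touching D Q even-Q {i} {j} s<i i≤t s<j j≤t ci cj = ¬co-adj⇒adj p≢ λ pi-pj →
      no-odd-through Ḡ (proj₂ berge) Q′ (subst (2 ≤_) (sym len-Q′) (m≤n⇒m≤1+n (long Q)))
        (trans (cong parity len-Q′) (odd-suc (Through.len Q) even-Q))
        (Graph.symm Ḡ pi-pj) (D′.co-x s<j j≤t cj)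
        (λ { (here refl) → adj⇒¬co-adj (All.lookup cj x∈Ry)
           ; (there z∈)  → adj⇒¬co-adj (All.lookup cj (W⊆y z∈)) })
      where
      open PairCase D
      module D′ = PairCase (pair-swap Ḡ D)
      Q′ = proj₁ (extend s<i i≤t ci Q)
      len-Q′ = proj₂ (extend s<i i≤t ci Q)
      p≢ : p i ≢ p j
      p≢ = distinct′ path (<⇒≤ s<i) i≤t (<⇒≤ s<j) j≤t λ { refl → not-both cover s<i i≤t ci cj }

    -- A W-complete vertex adjacent to neither x nor y would close the odd antipath Q to an odd
    -- antihole; hence the two positions are consecutive among the W-complete ones.
    odd-switch : (D : Pair Ḡ X) (Q : Through Ḡ (Pair.W D) (Pair.x D) (Pair.y D)) → Odd (Through.len Q) →
      EvenSwitch (Complete (Rx D) ∘ p) (Complete (Ry D) ∘ p) s t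
    odd-switch D Q odd-Q {i} {j} s<i i<j j≤t ci cj gapx gapy = result (Pair.kind D)
      where
      open PairCase D hiding (Rx; Ry)
      module D′ = PairCase (pair-swap Ḡ D)
      s≤i = <⇒≤ s<i
      i≤t = ≤-trans (<⇒≤ i<j) j≤t
      s<j = <-trans s<i i<j
      result : (∃ λ c → W ≡ c ∷ []) ⊎ X ⊆ˡ x ∷ y ∷ W → parity i ≡ parity j
      result (inj₁ (c , refl)) = contradiction odd-Q (no-odd-through-singleton Ḡ x≢y x≁y Q)
      result (inj₂ cov) with complete-spaced part-W s≤i i<j j≤t (anti-mono W⊆x ci) (anti-mono W⊆y cj) gap
        where
        gap : Gap (Complete W ∘ p) i j
        gap {k} i<k k<j cW = no-odd-through Ḡ (proj₂ berge) Q (long Q) odd-Q co-x′ co-y′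
          (λ z∈ → adj⇒¬co-adj (All.lookup cW z∈))
          where
          s≤k = ≤-trans s≤i (<⇒≤ i<k)
          k≤t = ≤-trans (<⇒≤ k<j) j≤t
          co-y′ : Adj Ḡ (p k) y
          co-y′ = (λ { refl → off-X s≤k k≤t y∈ }) , λ ~y → gapx i<k k<j (All.tabulate λ z∈ →
            adj ~y z∈ (cov (Without.within minusX z∈)))
            where
            adj : ∀ {z} → Adj G (p k) y → z ∈ˡ Rx D → z ∈ˡ x ∷ y ∷ W → Adj G (p k) z
            adj ~y z∈ (here refl)         = contradiction z∈ (Without.removed minusX)
            adj ~y z∈ (there (here refl)) = ~y
            adj ~y z∈ (there (there z∈W)) = All.lookup cW z∈W
          co-x′ : Adj Ḡ (p k) x
          co-x′ = (λ { refl → off-X s≤k k≤t x∈ }) , λ ~x → gapy i<k k<j (All.tabulate λ z∈ →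
            adj ~x z∈ (cov (Without.within minusY z∈)))
            where
            adj : ∀ {z} → Adj G (p k) x → z ∈ˡ Ry D → z ∈ˡ x ∷ y ∷ W → Adj G (p k) z
            adj ~x z∈ (here refl)         = ~x
            adj ~x z∈ (there (here refl)) = contradiction z∈ (Without.removed minusY)
            adj ~x z∈ (there (there z∈W)) = All.lookup cW z∈W
      ... | inj₂ same = same
      -- The positions are adjacent on P, and prolonging `Q` by p_i before x and by p_j after y
      -- gives an antipath two longer, hence odd, with interior in X.
      ... | inj₁ refl = ⊥-elim (no-bad (λ z → z) s<i j≤t
              (mkBad ≤-refl (n≢1+n-parity i) (inj₂ (refl , through-mono Ḡ within (through-sym Ḡ Q″) , odd-Q″))))
        where
        Q′ = proj₁ (extend s<i i≤t ci Q)
        pj~pi : Adj G (p j) (p i)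
        pj~pi = Graph.symm G (edge path s≤i j≤t)
        step : Σ (Through Ḡ (y ∷ x ∷ W) (p j) (p i)) λ L → Through.len L ≡ suc (Through.len Q′)
        step = through-cons Ḡ (D′.co-x s<j j≤t cj) (proj₁ (D′.co-x s<j j≤t cj))
          (adj⇒¬co-adj pj~pi) (adj⇒≢ pj~pi)
          (λ { (here refl) → adj⇒¬co-adj (All.lookup cj x∈Ry)
             ; (there z∈)  → adj⇒¬co-adj (All.lookup cj (W⊆y z∈)) })
          (λ { (here e) → off-X (<⇒≤ s<j) j≤t (subst (_∈ˡ X) (sym e) x∈)
             ; (there z∈) → off-W (<⇒≤ s<j) j≤t z∈ })
          (through-sym Ḡ Q′)
        Q″ = proj₁ step
        odd-Q″ : Odd (Through.len Q″)
        odd-Q″ = trans (cong parity (trans (proj₂ step) (cong suc (proj₂ (extend s<i i≤t ci Q))))) odd-Q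
        within : y ∷ x ∷ W ⊆ˡ X
        within (here refl)         = y∈
        within (there (here refl)) = x∈
        within (there (there z∈))  = W⊆X z∈

    pair⇒⊥ : ¬ Pair Ḡ X
    pair⇒⊥ D = by-parity (parity (Through.len Q)) refl
      where
      open PairCase D
      Q : Through Ḡ W x y
      Q = tree-through Ḡ W-tree u∈ x~u w∈ y~w
      part-y = PairCase.part-x (pair-swap Ḡ D)
      by-parity : ∀ π → parity (Through.len Q) ≡ π → ⊥
      by-parity 0ℙ par = touching⇒⊥ part-x part-y cover (touching D Q par)
      by-parity 1ℙ par = even-switch⇒⊥ part-x part-y cover
        (odd-switch D Q par) (odd-switch (pair-swap Ḡ D) (through-sym Ḡ Q) par)

  -- The case of a stable set X

  -- These are the facts about P that the next induction uses, isolated because they survive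
  -- reversal with the same X; reversing a `Setting` would exchange X and Y.
  record Regular (X : List V) (q : ℕ → V) (lo hi : ℕ) : Set where
    field
      spaced : ∀ {D} → Tree Ḡ D → D ⊆ˡ X → length D < length X → Spaced (Complete D ∘ q) lo hi
      switch : ∀ {a c i j} → a ∈ˡ X → c ∈ˡ X → lo ≤ i → i < j → j ≤ hi →
        Adj G (q i) c → ¬ Adj G (q i) a → Adj G (q j) a → ¬ Adj G (q j) c →
        Gap (λ k → Adj G (q k) a) i j → Gap (λ k → Adj G (q k) c) i j → parity i ≡ parity j

  regular-reverse : ∀ {X q lo hi} → Regular X q lo hi → Regular X (λ k → q (lo + hi ∸ k)) lo hi
  regular-reverse {X} {q} {lo} {hi} R = record
    { spaced = λ T D⊆X short lo≤i i<j j≤hi ci cj gap →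
        spaced′ i<j (≤N j≤hi)
          (Regular.spaced R T D⊆X short (∸-lower lo hi j≤hi) (flip i<j j≤hi) (∸-upper lo hi lo≤i) cj ci
            (gap-unreflect (Complete _ ∘ q) i<j (≤N j≤hi) gap))
    ; switch = λ a∈ c∈ lo≤i i<j j≤hi i~c i≁a j~a j≁c gap-a gap-c →
        sym (parity-reflect (≤N j≤hi) (≤N (≤-trans (<⇒≤ i<j) j≤hi))
          (Regular.switch R c∈ a∈ (∸-lower lo hi j≤hi) (flip i<j j≤hi) (∸-upper lo hi lo≤i) j~a j≁c i~c i≁a
            (gap-unreflect (λ k → Adj G (q k) _) i<j (≤N j≤hi) gap-c) (gap-unreflect (λ k → Adj G (q k) _) i<j (≤N j≤hi) gap-a)))
    }
    where
    N = lo + hi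
    ≤N : ∀ {k} → k ≤ hi → k ≤ N
    ≤N k≤hi = ≤-trans k≤hi (m≤n+m hi lo)
    flip : ∀ {i j} → i < j → j ≤ hi → N ∸ j < N ∸ i
    flip i<j j≤hi = ∸-monoʳ-< i<j (≤N j≤hi)
    spaced′ : ∀ {i j} → i < j → j ≤ N → N ∸ i ≡ suc (N ∸ j) ⊎ parity (N ∸ j) ≡ parity (N ∸ i) →
      j ≡ suc i ⊎ parity i ≡ parity j
    spaced′ {i} {j} i<j j≤N (inj₁ e) = inj₁ (∸-cancelˡ-≡ j≤N (≤-trans i<j j≤N)
      (suc-injective (trans (sym e) (m∸n≡1+[m∸1+n] (≤-trans i<j j≤N)))))
    spaced′ {i} {j} i<j j≤N (inj₂ e) = inj₂ (sym (parity-reflect j≤N (≤-trans (<⇒≤ i<j) j≤N) e))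

  -- Induction on D = b ∷ D′: scan the segment for its D′-complete positions and its neighbours of
  -- b.  The hypothesis for (a, D′) applies to the last position of either kind, and the one for
  -- (b, D′) to the switches; these occur in both directions, hence the second statement.
  mutual

    even-to-neighbour : ∀ {X q lo hi a D i j} → Regular X q lo hi → 1 < length X → a ∈ˡ X →
      Tree Ḡ D → D ⊆ˡ X → length D < length X → lo ≤ i → i < j → j ≤ hi →
      Complete D (q i) → ¬ Adj G (q i) a → Adj G (q j) a → ¬ Complete D (q j) →
      Gap (Complete D ∘ q) i j → Gap (λ k → Adj G (q k) a) i j → parity i ≡ parity j
    even-to-neighbour R 1<X a∈ (root c) D⊆X _ lo≤i i<j j≤hi (i~c ∷ []) i≁a j~a ¬cj gap-D gap-a =
      Regular.switch R a∈ (D⊆X (here refl)) lo≤i i<j j≤hi i~c i≁a j~a (λ j~c → ¬cj (j~c ∷ [])) gap-a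
        (λ i<k k<j k~c → gap-D i<k k<j (k~c ∷ []))
    even-to-neighbour {X} {q} {lo} {hi} {a} {b ∷ D} {i} {j} R 1<X a∈ (attach _ _ _ T) bD⊆X short lo≤i i<j j≤hi
      (i~b ∷ ci) i≁a j~a ¬cj gap-bD gap-a
      -- Position i starts the scan as both kinds at once. No later position up to j is both: before
      -- j this is the gap, at j the assumption that q_j is not complete.
      = conclude (scan (complete? D ∘ q) (complete? (b ∷ []) ∘ q)
          (<⇒≤ i<j) ci (i~b ∷ []) disjoint
          (spaced-in T (bD⊆X ∘ there) D-short) (spaced-in (root b) (λ { (here refl) → b∈ }) 1<X) D-b b-D)
      where
      b∈ : b ∈ˡ X
      b∈ = bD⊆X (here refl)
      D-short : length D < length X
      D-short = <-trans ≤-refl short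
      disjoint : ∀ {k} → i < k → k ≤ j → Complete D (q k) → ¬ Complete (b ∷ []) (q k)
      disjoint i<k k≤j ck (k~b ∷ []) with m≤n⇒m<n∨m≡n k≤j
      ... | inj₁ k<j  = gap-bD i<k k<j (k~b ∷ ck)
      ... | inj₂ refl = ¬cj (k~b ∷ ck)
      spaced-in : ∀ {E} → Tree Ḡ E → E ⊆ˡ X → length E < length X → Spaced (Complete E ∘ q) i j
      spaced-in T′ E⊆X E-short i≤k k<l l≤j = Regular.spaced R T′ E⊆X E-short (≤-trans lo≤i i≤k) k<l (≤-trans l≤j j≤hi)
      D-b : EvenSwitch (Complete D ∘ q) (Complete (b ∷ []) ∘ q) i j
      D-b {k} {l} i<k k<l l≤j ck (l~b ∷ []) gap-D gap-b =
        even-to-neighbour R 1<X b∈ T (bD⊆X ∘ there) D-short (≤-trans lo≤i (<⇒≤ i<k)) k<l (≤-trans l≤j j≤hi)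
          ck (λ k~b → disjoint i<k (≤-trans (<⇒≤ k<l) l≤j) ck (k~b ∷ [])) l~b
          (λ cl → disjoint (<-trans i<k k<l) l≤j cl (l~b ∷ [])) gap-D
          (λ k<m m<l m~b → gap-b k<m m<l (m~b ∷ []))
      b-D : EvenSwitch (Complete (b ∷ []) ∘ q) (Complete D ∘ q) i j
      b-D {k} {l} i<k k<l l≤j (k~b ∷ []) cl gap-b gap-D =
        even-from-neighbour R 1<X b∈ T (bD⊆X ∘ there) D-short (≤-trans lo≤i (<⇒≤ i<k)) k<l (≤-trans l≤j j≤hi)
          k~b (λ ck → disjoint i<k (≤-trans (<⇒≤ k<l) l≤j) ck (k~b ∷ [])) cl
          (λ l~b → disjoint (<-trans i<k k<l) l≤j cl (l~b ∷ [])) gap-D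
          (λ k<m m<l m~b → gap-b k<m m<l (m~b ∷ []))
      not-a : ∀ {k} → i < k ⊎ i ≡ k → k < j → ¬ Adj G (q k) a
      not-a (inj₁ i<k)  k<j = gap-a i<k k<j
      not-a (inj₂ refl) _   = i≁a
      from-D : ∀ {α} → Last (Complete D ∘ q) i j α → α < j ⊎ α ≡ j → parity α ≡ parity j
      from-D lα (inj₂ α≡j) = cong parity α≡j
      from-D lα (inj₁ α<j) = even-to-neighbour R 1<X a∈ T (bD⊆X ∘ there) D-short
        (≤-trans lo≤i (Last.lower lα)) α<j j≤hi (Last.holds lα) (not-a (m≤n⇒m<n∨m≡n (Last.lower lα)) α<j) j~a
        (Last.none lα α<j ≤-refl)
        (λ α<k k<j → Last.none lα α<k (<⇒≤ k<j)) (λ α<k k<j → gap-a (≤-<-trans (Last.lower lα) α<k) k<j)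
      from-b : ∀ {β} → Last (Complete (b ∷ []) ∘ q) i j β → β < j ⊎ β ≡ j → parity β ≡ parity j
      from-b lβ (inj₂ β≡j) = cong parity β≡j
      from-b lβ (inj₁ β<j) = Regular.switch R a∈ b∈
        (≤-trans lo≤i (Last.lower lβ)) β<j j≤hi (All.head (Last.holds lβ))
        (not-a (m≤n⇒m<n∨m≡n (Last.lower lβ)) β<j) j~a (λ j~b → Last.none lβ β<j ≤-refl (j~b ∷ []))
        (λ β<k k<j → gap-a (≤-<-trans (Last.lower lβ) β<k) k<j)
        (λ β<k k<j k~b → Last.none lβ β<k (<⇒≤ k<j) (k~b ∷ []))
      -- The smaller last position has the parity of i by the scan, and that of j because the next
      -- neighbour of a after it is q_j.
      conclude : Scanned (Complete D ∘ q) (Complete (b ∷ []) ∘ q) i j → parity i ≡ parity j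
      conclude (α , β , lα , lβ , α≤β⇒ , β≤α⇒) with ≤-total α β
      ... | inj₁ α≤β = trans (sym (α≤β⇒ α≤β)) (from-D lα (m≤n⇒m<n∨m≡n (Last.upper lα)))
      ... | inj₂ β≤α = trans (sym (β≤α⇒ β≤α)) (from-b lβ (m≤n⇒m<n∨m≡n (Last.upper lβ)))

    even-from-neighbour : ∀ {X q lo hi a D i j} → Regular X q lo hi → 1 < length X → a ∈ˡ X →
      Tree Ḡ D → D ⊆ˡ X → length D < length X → lo ≤ i → i < j → j ≤ hi →
      Adj G (q i) a → ¬ Complete D (q i) → Complete D (q j) → ¬ Adj G (q j) a →
      Gap (Complete D ∘ q) i j → Gap (λ k → Adj G (q k) a) i j → parity i ≡ parity j
    even-from-neighbour {X} {q} {lo} {hi} {a} {D} {i} {j} R 1<X a∈ T D⊆X short lo≤i i<j j≤hi i~a ¬ci cj j≁a gap-D gap-a =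
      sym (parity-reflect j≤N i≤N (even-to-neighbour (regular-reverse R) 1<X a∈ T D⊆X short
        (∸-lower lo hi j≤hi) (∸-monoʳ-< i<j j≤N) (∸-upper lo hi lo≤i)
        (back {Complete D} j≤N cj) (λ adj → j≁a (forth {λ z → Adj G z a} j≤N adj))
        (back {λ z → Adj G z a} i≤N i~a) (λ c → ¬ci (forth {Complete D} i≤N c))
        (gap-reflect (Complete D ∘ q) i<j j≤N gap-D) (gap-reflect (λ k → Adj G (q k) a) i<j j≤N gap-a)))
      where
      N = lo + hi
      j≤N : j ≤ N
      j≤N = ≤-trans j≤hi (m≤n+m hi lo)
      i≤N : i ≤ N
      i≤N = ≤-trans (<⇒≤ i<j) j≤N
      back : ∀ {A : V → Set} {k} → k ≤ N → A (q k) → A (q (N ∸ (N ∸ k)))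
      back {A} k≤N = subst (A ∘ q) (sym (m∸[m∸n]≡n k≤N))
      forth : ∀ {A : V → Set} {k} → k ≤ N → A (q (N ∸ (N ∸ k))) → A (q k)
      forth {A} k≤N = subst (A ∘ q) (m∸[m∸n]≡n k≤N)

  -- A clique of the complement is stable in G, so two neighbouring positions of a switch between
  -- distinct single vertices supply the nonadjacent ends of a leap. The head of the list is split
  -- off as U, and the tail is W.
  clique⇒⊥ : ∀ {X Y p s t} → ClaimBelow (length X + length Y) → Setting X Y p s t →
    ¬ Bad X p (suc s) t → ¬ Bad Y p s (pred t) → t ≢ suc (suc s) →
    2 ≤ length X → ¬ Clique Ḡ X
  clique⇒⊥ {X} {Y} {p} {s} {t} ih S ¬bX ¬bY t≢2+s 2≤X clique with Setting.X-tree S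
  ... | root _ = contradiction 2≤X (<-irrefl refl)
  ... | attach {a} {xs = D} _ d∈ _ T = even-switch⇒⊥ part-a part-D (λ { (~a ∷ []) cD → ~a ∷ cD })
    (λ { s<i i<j j≤t (i~a ∷ []) cj gap-a gap-D → even-from-neighbour R 2≤X (here refl) T there ≤-refl s<i i<j j≤t
           i~a (λ ci → onlyX s<i (≤-trans (<⇒≤ i<j) j≤t) (i~a ∷ ci)) cj (λ j~a → onlyX (<-trans s<i i<j) j≤t (j~a ∷ cj))
           gap-D (λ i<k k<j k~a → gap-a i<k k<j (k~a ∷ [])) })
    (λ { s<i i<j j≤t ci (j~a ∷ []) gap-D gap-a → even-to-neighbour R 2≤X (here refl) T there ≤-refl s<i i<j j≤t
           ci (λ i~a → onlyX s<i (≤-trans (<⇒≤ i<j) j≤t) (i~a ∷ ci)) j~a (λ cj → onlyX (<-trans s<i i<j) j≤t (j~a ∷ cj))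
           gap-D (λ i<k k<j k~a → gap-a i<k k<j (k~a ∷ [])) })
    where
    open Setting S
    open Step ih S ¬bX ¬bY t≢2+s
    part-a : Part (a ∷ [])
    part-a = record { tree = root a ; sub = λ { (here refl) → here refl } ; short = 2≤X }
    part-D : Part D
    part-D = record { tree = T ; sub = there ; short = ≤-refl }
    R : Regular X p (suc s) t
    R = record
      { spaced = λ T′ D⊆X short s<i → complete-spaced (record { tree = T′ ; sub = D⊆X ; short = short }) (<⇒≤ s<i)
      ; switch = sw
      }
      where
      sw : ∀ {a c i j} → a ∈ˡ X → c ∈ˡ X → s < i → i < j → j ≤ t →
        Adj G (p i) c → ¬ Adj G (p i) a → Adj G (p j) a → ¬ Adj G (p j) c →
        Gap (λ k → Adj G (p k) a) i j → Gap (λ k → Adj G (p k) c) i j → parity i ≡ parity j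
      sw {a} {c} {i} {j} a∈ c∈ s<i i<j j≤t i~c i≁a j~a j≁c gap-a gap-c with parity i ℙₚ.≟ parity j
      ... | yes same = same
      -- An odd switch from a neighbour of c to a neighbour of a would be a leap with ends c and a.
      ... | no differ = ⊥-elim (no-bad (λ z → z) s<i j≤t (mkBad i<j differ (inj₁ record
        { x∈ = c∈ ; x′∈ = a∈
        ; x≁x′ = proj₂ (clique c∈ a∈ (λ { refl → i≁a i~c }))
        ; x~first = Graph.symm G i~c
        ; x≁rest  = x≁rest
        ; x′~last = Graph.symm G j~a
        ; x′≁rest = x′≁rest })))
        where
        x≁rest : ∀ {k} → i < k → k ≤ j → ¬ Adj G c (p k)
        x≁rest i<k k≤j c~k with m≤n⇒m<n∨m≡n k≤j
        ... | inj₁ k<j  = gap-c i<k k<j (Graph.symm G c~k)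
        ... | inj₂ refl = j≁c (Graph.symm G c~k)
        x′≁rest : ∀ {k} → i ≤ k → k < j → ¬ Adj G a (p k)
        x′≁rest i≤k k<j a~k with m≤n⇒m<n∨m≡n i≤k
        ... | inj₁ i<k  = gap-a i<k k<j (Graph.symm G a~k)
        ... | inj₂ refl = i≁a (Graph.symm G a~k)

  -- Paths of length two, singletons, and the induction

  record TwoAntipaths (X Y : List V) (a b c : V) : Set where
    field
      Q : Through Ḡ X b c
      R : Through Ḡ Y a b
      differ : parity (Through.len Q) ≢ parity (Through.len R)

  length-two : ∀ {X Y p s} → Setting X Y p s (2 + s) → TwoAntipaths X Y (p s) (p (1 + s)) (p (2 + s))
  length-two {X} {Y} {p} {s} S = record { Q = Q ; R = R ; differ = λ eq →
      even-step (Through.len R) (Through.len Q) (sym eq)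
        (trans (cong parity (sym (proj₂ ext))) (sym (two-paths (proj₂ berge) Q.path R″.path
          (long 1 ≤-refl Q) (subst (2 ≤_) (sym (proj₂ ext)) (s≤s (≤-trans (n≤1+n 1) (long 0 z≤n R))))
          (trans Q.start (sym R″.finish)) (trans Q.finish (sym R″.start)) cross apart))) }
    where
    open Setting S
    long : ∀ {T} i → i ≤ 1 → (L : Through Ḡ T (p (i + s)) (p (suc (i + s)))) → 2 ≤ Through.len L
    long i i≤1 = through-long Ḡ (distinct path (m≤n+m s i) ≤-refl (+-monoˡ-≤ s (s≤s i≤1)))
                           (adj⇒¬co-adj (edge path (m≤n+m s i) (+-monoˡ-≤ s (s≤s i≤1))))
    ≤1 : s ≤ 1 + s
    ≤1 = n≤1+n s
    ≤2 : s ≤ 2 + s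
    ≤2 = m≤n⇒m≤1+n ≤1
    Q : Through Ḡ X (p (1 + s)) (p (2 + s))
    Q = between X-tree (onlyX ≤-refl (n≤1+n _)) (off-X ≤1 (n≤1+n _)) (onlyX (n≤1+n _) ≤-refl) (off-X ≤2 ≤-refl)
    R : Through Ḡ Y (p s) (p (1 + s))
    R = between Y-tree (onlyY ≤-refl s<t) (off-Y ≤-refl (<⇒≤ s<t)) (onlyY ≤1 ≤-refl) (off-Y ≤1 (n≤1+n _))
    ends : Adj Ḡ (p (2 + s)) (p s)
    ends = ≢-sym (distinct path ≤-refl s<t ≤-refl) , chordless′ path ≤-refl ≤-refl ≤-refl
    back : Adj G (p (2 + s)) (p (1 + s))
    back = Graph.symm G (edge path ≤1 ≤-refl)
    -- The first and last vertices of P are nonadjacent, and the last one is Y-complete, so it can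
    -- be put before the first one on `R`. As the first vertex is X-complete, the prolonged antipath
    -- meets `Q` only in its ends and closes it to an antihole.
    ext : Σ (Through Ḡ (p s ∷ Y) (p (2 + s)) (p (1 + s))) λ L → Through.len L ≡ suc (Through.len R)
    ext = through-cons Ḡ ends (proj₁ ends) (adj⇒¬co-adj back) (adj⇒≢ back)
      (λ z∈ → adj⇒¬co-adj (All.lookup endY z∈)) (off-Y ≤2 ≤-refl) R
    module Q = Through Q
    module R″ = Through (proj₁ ext)
    adjacent : ∀ {x z} → x ∈ˡ X → z ∈ˡ p s ∷ Y → Adj G x z
    adjacent x∈ (here refl) = Graph.symm G (All.lookup startX x∈)
    adjacent x∈ (there z∈)  = X~Y x∈ z∈
    cross : ∀ {i j} → 0 < i → i < Q.len → 0 < j → j < R″.len → ¬ Adj Ḡ (Q.walk i) (R″.walk j)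
    cross 0<i i< 0<j j< = adj⇒¬co-adj (adjacent (Q.inner 0<i i<) (R″.inner 0<j j<))
    apart : ∀ {i j} → 0 < i → i < Q.len → 0 < j → j < R″.len → Q.walk i ≢ R″.walk j
    apart 0<i i< 0<j j< = adj⇒≢ (adjacent (Q.inner 0<i i<) (R″.inner 0<j j<))

  length-two⇒⊥ : ∀ {X Y p s} → Setting X Y p s (2 + s) →
    ¬ Bad X p (1 + s) (2 + s) → ¬ Bad Y p s (1 + s) → ⊥
  length-two⇒⊥ {s = s} S ¬bX ¬bY = by-parity (parity (Through.len Q)) refl
    where
    open TwoAntipaths (length-two S)
    by-parity : ∀ π → parity (Through.len Q) ≡ π → ⊥
    by-parity 1ℙ odd  = ¬bX (mkBad ≤-refl (n≢1+n-parity (suc s)) (inj₂ (refl , Q , odd)))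
    by-parity 0ℙ even = ¬bY (mkBad ≤-refl (n≢1+n-parity s)
      (inj₂ (refl , R , sym (≢⇒≡⁻¹ (differ ∘ trans even)))))

  -- The hole is y, x, p_s, ..., p_t, with t - s + 3 vertices.
  singletons⇒⊥ : ∀ {x y p s t} → ¬ Setting (x ∷ []) (y ∷ []) p s t
  singletons⇒⊥ {x} {y} {p} {s} {t} S = no-odd-cycle G (proj₁ berge) P′ (s≤s 1≤m) (odd-suc m even-m)
      (Graph.symm G (X~Y (here refl) (here refl))) (subst (Adj G y ∘ p) (sym s+m≡t) (Graph.symm G (All.lookup endY (here refl))))
      inner
    where
    open Setting S
    m = t ∸ s
    s≤t = <⇒≤ s<t
    s+m≡t : s + m ≡ t
    s+m≡t = m+[n∸m]≡n s≤t
    1≤m : 1 ≤ m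
    1≤m = m<n⇒0<n∸m s<t
    even-m : Even m
    even-m = ℙₚ.+-cancelʳ-≡ (parity s) (parity m) 0ℙ (trans (sym (parity-∸ s≤t)) (sym even))
    up : ∀ {k} → k ≤ m → s + k ≤ t
    up {k} k≤m = subst (s + k ≤_) s+m≡t (+-monoʳ-≤ s k≤m)
    P′ : Path G (x ◂ (λ k → p (s + k))) 0 (suc m)
    P′ = path-cons (path-shift m (≤-reflexive s+m≡t) path)
      (subst (Adj G x ∘ p) (sym (+-identityʳ s)) (Graph.symm G (All.lookup startX (here refl))))
      (λ 0<k k≤m x~ → onlyX (m<m+n s 0<k) (up k≤m) (Graph.symm G x~ ∷ []))
      (λ {k} k≤m x≡ → off-X (m≤m+n s k) (up k≤m) (here (sym x≡)))
    inner : ∀ {k} → 0 < k → k < suc m → ¬ Adj G y ((x ◂ (λ k → p (s + k))) k)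
    inner {suc k} _ k< y~ = onlyY (m≤m+n s k) (subst (s + k <_) s+m≡t (+-monoʳ-< s (s≤s⁻¹ k<))) (Graph.symm G y~ ∷ [])

  large⇒⊥ : ∀ {X Y p s t} → ClaimBelow (length X + length Y) → Setting X Y p s t →
    ¬ Bad X p (suc s) t → ¬ Bad Y p s (pred t) → t ≢ suc (suc s) → 2 ≤ length X → ⊥
  large⇒⊥ ih S ¬bX ¬bY t≢2+s 2≤X with clique-or-pair Ḡ (Setting.X-tree S)
  ... | inj₁ clique = clique⇒⊥ ih S ¬bX ¬bY t≢2+s 2≤X clique
  ... | inj₂ pair   = Step.pair⇒⊥ ih S ¬bX ¬bY t≢2+s pair

  claim-from-below : ∀ {X Y} → ClaimBelow (length X + length Y) → Claim X Y
  claim-from-below {X} {Y} ih {p} {s} {t} S ¬bX ¬bY with t ≟ suc (suc s)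
  ... | yes refl = length-two⇒⊥ S ¬bX ¬bY
  ... | no t≢2+s with Setting.X-tree S | Setting.Y-tree S
  ...   | root _ | root _ = singletons⇒⊥ S
  ...   | attach _ d∈ _ _ | _ = large⇒⊥ ih S ¬bX ¬bY t≢2+s (1<1+length d∈)
  -- Only Y has more than one vertex, so P is reversed to exchange the two sets.
  ...   | root x | attach {xs = D} _ d∈ _ _ = large⇒⊥ (subst (ClaimBelow) (+-comm 1 (suc (length D))) ih) (setting-reverse S)
          (¬bad-last (Setting.s<t S) ¬bY) (¬bad-first (Setting.s<t S) ¬bX) t≢2+s (1<1+length d∈)

  claim-below : ∀ n → ClaimBelow n
  claim-below (suc n) {X} {Y} small = claim-from-below (λ smaller → claim-below n (<-≤-trans smaller (s≤s⁻¹ small)))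

  claim : ∀ {X Y} → Claim X Y
  claim {X} {Y} = claim-below (suc (length X + length Y)) ≤-refl

  -- From the refutation to the theorem

  leap⇒isPath : ∀ {T n} (us : Vec V (suc n)) → Path G (at us) 0 n → 0 < n → (∀ {i} → i ≤ n → at us i ∉ˡ T) →
    (L : Leap T (at us) 0 n) → IsPath G (Leap.x L ∷ (us ∷ʳ Leap.x′ L))
  leap⇒isPath {T} {n} us P 0<n off L = path⇒isPath G (x ∷ (us ∷ʳ x′)) ≗cons
    (path-cons P′ (subst (Adj G x) (sym (at-∷ʳ us x′ z≤n)) x~first) rest new)
    where
    open Leap L
    q = at (us ∷ʳ x′)
    q-last : q (suc n) ≡ x′
    q-last = trans (at-last (us ∷ʳ x′)) (last-∷ʳ x′ us)
    ≗cons : ∀ i → lookup (x ∷ (us ∷ʳ x′)) i ≡ (x ◂ q) (toℕ i)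
    ≗cons zero    = refl
    ≗cons (suc i) = lookup-at (us ∷ʳ x′) i
    P′ : Path G q 0 (suc n)
    P′ = path-snoc P (at-∷ʳ us x′) (subst (Adj G (at us n)) (sym q-last) (Graph.symm G x′~last))
      (λ i<n ~ → x′≁rest z≤n i<n (Graph.symm G (subst (Adj G _) q-last ~)))
      (λ i≤n eq → off i≤n (subst (_∈ˡ T) (sym (trans eq q-last)) x′∈))
    rest : ∀ {i} → 0 < i → i ≤ suc n → ¬ Adj G x (q i)
    rest 0<i i≤ x~i with m≤n⇒m<n∨m≡n i≤
    ... | inj₁ i<   = x≁rest 0<i (s≤s⁻¹ i<) (subst (Adj G x) (at-∷ʳ us x′ (s≤s⁻¹ i<)) x~i)
    ... | inj₂ refl = x≁x′ (subst (Adj G x) q-last x~i)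
    new : ∀ {i} → i ≤ suc n → x ≢ q i
    new i≤ eq with m≤n⇒m<n∨m≡n i≤
    ... | inj₁ i<   = off (s≤s⁻¹ i<) (subst (_∈ˡ T) (trans eq (at-∷ʳ us x′ (s≤s⁻¹ i<))) x∈)
    ... | inj₂ refl = x′≁rest ≤-refl 0<n (subst (λ z → Adj G z (at us 0)) (trans eq q-last) x~first)

  through⇒antipath : ∀ {T X a b} → (∀ {x} → x ∈ˡ T → x ∈ X) → (L : Through Ḡ T a b) →
    AntipathBetween G X a b (Through.len L)
  through⇒antipath T⊆X L = us , path⇒isPath Ḡ us us≗ path , start , trans (last-≗ us walk us≗) finish ,
    λ i 0<i i< → subst (_∈ _) (sym (us≗ i)) (T⊆X (inner 0<i i<))
    where
    open Through L
    us = tabulate (λ i → walk (toℕ i))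
    us≗ = lookup∘tabulate (λ i → walk (toℕ i))

  -- The claim only refutes the absence of leaps; searching the finitely many pairs turns this into
  -- explicit vertices.
  isLeap? : (X : Subset v) → ∀ {n} (us : Vec V n) →
    Dec (LeapPath G X us)
  isLeap? X us = Finₚ.any? λ x → Finₚ.any? λ x′ →
    (x ∈? X) ×-dec (x′ ∈? X) ×-dec ¬? (Graph.adj? G x x′) ×-dec isPath? G (x ∷ (us ∷ʳ x′))

  leap-unbalanced : ∀ {A X n x x′} (us : Vec V n) → (∀ i → lookup us i ∈ A) → Odd (suc n) →
    x ∈ X → x′ ∈ X → ¬ Adj G x x′ → IsPath G (x ∷ (us ∷ʳ x′)) → ¬ Balanced G A X
  leap-unbalanced {A} {n = n} {x} {x′} us us∈ odd x∈ x′∈ x≁x′ isPath (no-path , _) =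
    no-path x∈ x′∈ x≁x′ odd (x ∷ (us ∷ʳ x′) , isPath , refl , last-∷ʳ x′ (x ∷ us) , interior)
    where
    inner : ∀ {m} (ws : Vec V m) → (∀ i → lookup ws i ∈ A) → (i : Fin (suc m)) → toℕ i < m → lookup (ws ∷ʳ x′) i ∈ A
    inner (w ∷ ws) ws∈ zero    _  = ws∈ zero
    inner (w ∷ ws) ws∈ (suc i) i< = inner ws (ws∈ ∘ suc) i (s≤s⁻¹ i<)
    interior : InteriorIn A (x ∷ (us ∷ʳ x′))
    interior (suc i) _ i< = inner us us∈ i (s≤s⁻¹ i<)

  module _ {X Y : Subset v}
    (X-span : Spanning (complement G) X) (Y-span : Spanning (complement G) Y) (X~Y : CompleteTo G X Y) where

    open Spanning X-span using () renaming (list to LX; tree to X-tree; sound to LX⊆; complete to X⊆)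
    open Spanning Y-span using () renaming (list to LY; tree to Y-tree; sound to LY⊆; complete to Y⊆)

    module Translation {k : ℕ} (p₁ p₂ : Fin v) (ps : Vec (Fin v) k) (isPath : IsPath G (p₁ ∷ p₂ ∷ ps))
      (P⊆ : vertices (p₁ ∷ p₂ ∷ ps) ⊆ ∁ (X ∪ Y)) (even : Even (suc k))
      (p₁-only : UniqueComplete G X (p₁ ∷ p₂ ∷ ps) p₁) (pₙ-only : UniqueComplete G Y (p₁ ∷ p₂ ∷ ps) (last (p₁ ∷ p₂ ∷ ps))) where

      P : Vec (Fin v) (suc (suc k))
      P = p₁ ∷ p₂ ∷ ps

      p : ℕ → Fin v
      p = at P

      path-P : Path G p 0 (suc k)
      path-P = isPath⇒path P isPath

      p-last : p (suc k) ≡ last P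
      p-last = at-last P

      off : ∀ {j} → j ≤ suc k → p j ∉ X ∪ Y
      off j≤ = x∈∁p⇒x∉p (P⊆ (at∈vertices P j≤))

      S : Setting LX LY p 0 (suc k)
      S = record
        { X-tree = X-tree ; Y-tree = Y-tree
        ; X~Y    = λ x∈ y∈ → X~Y (LX⊆ x∈) (LY⊆ y∈)
        ; path   = path-P
        ; s<t    = s≤s z≤n
        ; even   = sym even
        ; off-X  = λ _ j≤ x∈ → off j≤ (x∈p∪q⁺ (inj₁ (LX⊆ x∈)))
        ; off-Y  = λ _ j≤ y∈ → off j≤ (x∈p∪q⁺ (inj₂ (LY⊆ y∈)))
        ; startX = All.tabulate (λ x∈ → proj₁ (proj₂ p₁-only) (LX⊆ x∈))
        ; onlyX  = λ 0<j j≤ c → distinct path-P z≤n 0<j j≤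
            (sym (proj₂ (proj₂ p₁-only) (at∈vertices P j≤) (λ x∈ → All.lookup c (X⊆ x∈))))
        ; endY   = All.tabulate (λ y∈ → subst (λ w → Adj G w _) (sym p-last) (proj₁ (proj₂ pₙ-only) (LY⊆ y∈)))
        ; onlyY  = λ _ j< c → distinct path-P z≤n j< ≤-refl
            (trans (proj₂ (proj₂ pₙ-only) (at∈vertices P (<⇒≤ j<)) (λ y∈ → All.lookup c (Y⊆ y∈))) (sym p-last))
        }

      after-p₁ : ∀ {j} → 0 < j → j ≤ suc k → p j ∈ vertices P - p₁
      after-p₁ 0<j j≤ = x∈p∧x≢y⇒x∈p-y (at∈vertices P j≤) (≢-sym (distinct path-P z≤n 0<j j≤))

      before-pₙ : ∀ {j} → j ≤ k → p j ∈ vertices P - last P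
      before-pₙ j≤ = x∈p∧x≢y⇒x∈p-y (at∈vertices P (m≤n⇒m≤1+n j≤))
        (λ eq → distinct path-P z≤n (s≤s j≤) ≤-refl (trans eq (sym p-last)))

      long-outcomes : 3 ≤ k → Dec (LeapPath G X (tail P)) → Dec (LeapPath G Y (init P)) → Outcomes G X Y k P
      long-outcomes 3≤k (yes (x₁ , x₂ , x₁∈ , x₂∈ , x₁≁x₂ , leap)) _ =
        inj₁ (s≤s 3≤k , x₁ , x₂ , x₁∈ , x₂∈ , x₁≁x₂ , leap) ,
        inj₁ (leap-unbalanced (tail P) in-tail (odd-suc (suc k) even) x₁∈ x₂∈ x₁≁x₂ leap)
        where
        in-tail : ∀ i → lookup (tail P) i ∈ vertices P - p₁
        in-tail i = subst (_∈ vertices P - p₁) (sym (lookup-at P (suc i))) (after-p₁ (s≤s z≤n) (s≤s (s≤s⁻¹ (toℕ<n i))))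
      long-outcomes 3≤k (no _) (yes (y₁ , y₂ , y₁∈ , y₂∈ , y₁≁y₂ , leap)) =
        inj₂ (inj₁ (s≤s 3≤k , y₁ , y₂ , y₁∈ , y₂∈ , y₁≁y₂ , leap)) ,
        inj₂ (leap-unbalanced (init P) in-init (odd-suc (suc k) even) y₁∈ y₂∈ y₁≁y₂ leap)
        where
        in-init : ∀ i → lookup (init P) i ∈ vertices P - last P
        in-init i = subst (_∈ vertices P - last P) (sym (trans (lookup-at (init P) i) (at-init P i≤k))) (before-pₙ i≤k)
          where
          i≤k : toℕ i ≤ k
          i≤k = s≤s⁻¹ (toℕ<n i)
      long-outcomes 3≤k (no ¬X) (no ¬Y) = ⊥-elim (claim S no-X no-Y)
        where
        0<k : 0 < k
        0<k = ≤-trans (s≤s z≤n) 3≤k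
        no-X : ¬ Bad LX p 1 (suc k)
        -- The antipath alternative needs a segment of length 1, whereas this one has length k ≥ 3.
        no-X (mkBad _ _ (inj₂ (refl , _))) = contradiction 3≤k λ { (s≤s ()) }
        no-X (mkBad _ _ (inj₁ L)) = ¬X (x , x′ , LX⊆ x∈ , LX⊆ x′∈ , x≁x′ ,
            leap⇒isPath (p₂ ∷ ps) (path-shift k ≤-refl (path-sub z≤n ≤-refl path-P)) 0<k
              (λ i≤k → Setting.off-X S z≤n (s≤s i≤k)) L′)
          where
          open Leap L
          L′ : Leap LX (at (p₂ ∷ ps)) 0 k
          L′ = record { x∈ = x∈ ; x′∈ = x′∈ ; x≁x′ = x≁x′ ; x~first = x~first
            ; x≁rest = λ 0<j j≤ → x≁rest (s≤s 0<j) (s≤s j≤) ; x′~last = x′~last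
            ; x′≁rest = λ _ j< → x′≁rest (s≤s z≤n) (s≤s j<) }
        no-Y : ¬ Bad LY p 0 k
        no-Y (mkBad _ _ (inj₂ (refl , _))) = contradiction 3≤k λ { (s≤s ()) }
        no-Y (mkBad _ _ (inj₁ L)) = ¬Y (x , x′ , LY⊆ x∈ , LY⊆ x′∈ , x≁x′ ,
            leap⇒isPath (init P) (path-ext (λ _ i≤k → sym (at-init P i≤k)) (path-sub z≤n (n≤1+n k) path-P)) 0<k
              (λ i≤k → subst (_∉ˡ LY) (sym (at-init P i≤k)) (Setting.off-Y S z≤n (m≤n⇒m≤1+n i≤k))) L′)
          where
          open Leap L
          L′ : Leap LY (at (init P)) 0 k
          L′ = record { x∈ = x∈ ; x′∈ = x′∈ ; x≁x′ = x≁x′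
            ; x~first = subst (Adj G x) (sym (at-init P z≤n)) x~first
            ; x≁rest  = λ 0<j j≤ ~ → x≁rest 0<j j≤ (subst (Adj G x) (at-init P j≤) ~)
            ; x′~last = subst (Adj G x′) (sym (at-init P ≤-refl)) x′~last
            ; x′≁rest = λ 0≤j j< ~ → x′≁rest 0≤j j< (subst (Adj G x′) (at-init P (<⇒≤ j<)) ~) }

    length-two-outcomes : (p₁ p₂ p₃ : Fin v) → IsPath G (p₁ ∷ p₂ ∷ p₃ ∷ []) →
      vertices (p₁ ∷ p₂ ∷ p₃ ∷ []) ⊆ ∁ (X ∪ Y) → UniqueComplete G X (p₁ ∷ p₂ ∷ p₃ ∷ []) p₁ →
      UniqueComplete G Y (p₁ ∷ p₂ ∷ p₃ ∷ []) p₃ →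
      TwoAntipaths LX LY p₁ p₂ p₃ → Outcomes G X Y 1 (p₁ ∷ p₂ ∷ p₃ ∷ [])
    length-two-outcomes p₁ p₂ p₃ isPath P⊆ p₁-only pₙ-only antipaths = by-parity (parity (Through.len Q)) refl
      where
      open Translation p₁ p₂ (p₃ ∷ []) isPath P⊆ refl p₁-only pₙ-only
      open TwoAntipaths antipaths
      Q′ : AntipathBetween G X p₂ p₃ (Through.len Q)
      Q′ = through⇒antipath LX⊆ Q
      R′ : AntipathBetween G Y p₁ p₂ (Through.len R)
      R′ = through⇒antipath LY⊆ R
      by-parity : ∀ π → parity (Through.len Q) ≡ π → Outcomes G X Y 1 P
      by-parity 1ℙ odd-Q = inj₂ (inj₂ (refl , _ , _ , Q′ , R′ ,
          inj₁ (odd-Q , sym (≢⇒≡⁻¹ (differ ∘ trans odd-Q))))) ,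
        inj₁ λ (_ , no-antipath) → no-antipath (after-p₁ {1} (s≤s z≤n) (s≤s z≤n)) (after-p₁ {2} (s≤s z≤n) ≤-refl)
          (edge path-P z≤n ≤-refl) odd-Q Q′
      by-parity 0ℙ even-Q = inj₂ (inj₂ (refl , _ , _ , Q′ , R′ , inj₂ (even-Q , odd-R))) ,
        inj₂ λ (_ , no-antipath) → no-antipath (before-pₙ {0} z≤n) (before-pₙ {1} ≤-refl) (edge path-P z≤n (s≤s z≤n)) odd-R R′
        where
        odd-R : Odd (Through.len R)
        odd-R = sym (≢⇒≡⁻¹ (differ ∘ trans even-Q))

    outcomes : ∀ k (P : Vec (Fin v) (suc (suc k))) → IsPath G P → vertices P ⊆ ∁ (X ∪ Y) → Even (suc k) →
      UniqueComplete G X P (head P) → UniqueComplete G Y P (last P) → Outcomes G X Y k P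
    -- `Even (suc k)` is empty for k = 0 and k = 2, so only k = 1 and k ≥ 3 remain.
    outcomes 1 (p₁ ∷ p₂ ∷ p₃ ∷ []) isPath P⊆ even p₁-only pₙ-only =
      length-two-outcomes p₁ p₂ p₃ isPath P⊆ p₁-only pₙ-only
        (length-two (Translation.S p₁ p₂ (p₃ ∷ []) isPath P⊆ even p₁-only pₙ-only))
    outcomes (suc (suc (suc k))) P@(p₁ ∷ p₂ ∷ ps) isPath P⊆ even p₁-only pₙ-only =
      Translation.long-outcomes p₁ p₂ ps isPath P⊆ even p₁-only pₙ-only (s≤s (s≤s (s≤s z≤n)))
        (isLeap? X (tail P)) (isLeap? Y (init P))

theorem2p9 :
    ∀ {v} (G : Graph v) → Berge G →
    (X Y : Subset v) → Empty (X ∩ Y) → Nonempty X → Nonempty Y →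
    Anticonnected G X → Anticonnected G Y → CompleteTo G X Y →
    -- P is the vector of p₁ , … , pₙ, with n = suc (suc k); its length suc k is positive
    (k : ℕ) (P : Vec (Fin v) (suc (suc k))) →
    IsPath G P → vertices P ⊆ ∁ (X ∪ Y) → Even (suc k) →
    let p₁ = head P
        p₂ = head (tail P)
        pₙ = last P
    in
    UniqueComplete G X P p₁ → UniqueComplete G Y P pₙ →
    ( ( 4 ≤ suc k ×
        ∃₂ λ x₁ x₂ → x₁ ∈ X × x₂ ∈ X × ¬ Adj G x₁ x₂ ×
          IsPath G (x₁ ∷ (tail P ∷ʳ x₂)) )
    ⊎ ( 4 ≤ suc k ×
        ∃₂ λ y₁ y₂ → y₁ ∈ Y × y₂ ∈ Y × ¬ Adj G y₁ y₂ ×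
          IsPath G (y₁ ∷ (init P ∷ʳ y₂)) )
    -- here n = 3, so that pₙ is p₃
    ⊎ ( suc k ≡ 2 ×
        ∃₂ λ q r → AntipathBetween G X p₂ pₙ q × AntipathBetween G Y p₁ p₂ r ×
          ((Odd q × Even r) ⊎ (Even q × Odd r)) ) )
    × ( ¬ Balanced G (vertices P - p₁) X ⊎ ¬ Balanced G (vertices P - pₙ) Y )
theorem2p9 G berge X Y _ X-nonempty Y-nonempty X-anti Y-anti X~Y k P isPath P⊆ even p₁-only pₙ-only =
  outcomes G berge (spanning (complement G) X-nonempty X-anti) (spanning (complement G) Y-nonempty Y-anti) X~Y
    k P isPath P⊆ even p₁-only pₙ-only
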